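{- Let $(a_n)_{n\ge0}$ be the sequence, listed in increasing order, of the non-negative integers $m$ such that $15m+1$ is a perfect square. Then $$\sum_{n=0}^\infty(-1)^{\lfloor (n+2)/4\rfloor}q^{a_n}=\frac{(q^2,q^6,q^8;q^8)_\infty\,(q^4,q^{12};q^{16})_\infty}{(q,q^4;q^5)_\infty}.$$
   Context: Here $q$ is a complex number with $|q|<1$ (equivalently, the identity may be read as an identity of formal power series in $q$). For a complex number $a$, $(a;q)_\infty:=\prod_{i=0}^\infty(1-aq^i)$, and $(a_1,a_2,\dots,a_m;q)_\infty:=\prod_{j=1}^m(a_j;q)_\infty$. $\lfloor x\rfloor$ is the floor function. -}

module Defs where

open import Data.Nat as ℕ using (ℕ; zero; suc; _∸_; _<_)
open import Data.Nat.DivMod using (_/_; _%_)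
open import Data.Nat.Divisibility using (_∣?_)
open import Data.Integer as ℤ using (ℤ; +_; -_)
open import Data.Product using (∃; _×_)
open import Relation.Nullary using (yes; no)
open import Relation.Binary.PropositionalEquality using (_≡_)

-- Formal power series in q with integer coefficients: n ↦ coefficient of q^n.
PS : Set
PS = ℕ → ℤ

sumTo : (ℕ → ℤ) → ℕ → ℤ
sumTo f zero    = + 0
sumTo f (suc n) = sumTo f n ℤ.+ f n

infixl 7 _⋆_
_⋆_ : PS → PS → PS
(f ⋆ g) n = sumTo (λ i → f i ℤ.* g (n ∸ i)) (suc n)

onePS : PS
onePS zero    = + 1
onePS (suc _) = + 0

oneMinus : ℕ → PS
oneMinus k zero with k ℕ.≟ 0
... | yes _ = + 0
... | no  _ = + 1
oneMinus k (suc n) with suc n ℕ.≟ k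
... | yes _ = - (+ 1)
... | no  _ = + 0

-- The series 1/(1 - q^k) = Σ_j q^{kj}  (used with k ≥ 1).
geom : ℕ → PS
geom k n with k ∣? n
... | yes _ = + 1
... | no  _ = + 0

prodTo : (ℕ → PS) → ℕ → PS
prodTo f zero    = onePS
prodTo f (suc k) = prodTo f k ⋆ f k

-- (q^a; q^b)_∞ = ∏_{i ≥ 0} (1 - q^{a + b i}), for a, b ≥ 1.
-- Factor i is 1 + O(q^{i+1}), so the coefficient of q^n equals that of
-- the finite product over i ≤ n.
poch : ℕ → ℕ → PS
poch a b n = prodTo (λ i → oneMinus (a ℕ.+ b ℕ.* i)) (suc n) n

invPoch : ℕ → ℕ → PS
invPoch a b n = prodTo (λ i → geom (a ℕ.+ b ℕ.* i)) (suc n) n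

Sq15 : ℕ → Set
Sq15 m = ∃ λ k → 15 ℕ.* m ℕ.+ 1 ≡ k ℕ.* k

IsEnumeration : (ℕ → ℕ) → Set
IsEnumeration a =
  (∀ n → a n < a (suc n)) ×
  (∀ n → Sq15 (a n)) ×
  (∀ m → Sq15 m → ∃ λ n → a n ≡ m)

sgn : ℕ → ℤ
sgn n with ((n ℕ.+ 2) / 4) % 2 ℕ.≟ 0
... | yes _ = + 1
... | no  _ = - (+ 1)

-- Σ_{n ≥ 0} (-1)^{⌊(n+2)/4⌋} q^{a n} as a formal power series.
-- Since a is strictly increasing, a n ≥ n, so only n ≤ N contribute to q^N.
lhsSeries : (ℕ → ℕ) → PS
lhsSeries a N = sumTo (λ n → indicator n) (suc N)
  where
  indicator : ℕ → ℤ
  indicator n with a n ℕ.≟ N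
  ... | yes _ = sgn n
  ... | no  _ = + 0

rhsSeries : PS
rhsSeries = poch 2 8 ⋆ poch 6 8 ⋆ poch 8 8 ⋆ poch 4 16 ⋆ poch 12 16
            ⋆ invPoch 1 5 ⋆ invPoch 4 5

{-# OPTIONS --safe #-}
-- Writing the roots of 15m + 1 as |15u + 1| and |15u + 4| with u ∈ ℤ, the left-hand side is
--   L = Σ_u (-1)^u q^(15u²+2u) + q Σ_u (-1)^u q^(15u²+8u),
-- the quintuple product of base q^10 at z = -q.  By the Jacobi triple product,
--   Σ_m q^(5m²+4m)         = (-q, -q^9, q^10; q^10)_∞,
--   Σ_n (-1)^n q^(10n²-2n) = (q^8, q^12, q^20; q^20)_∞.
-- In the product of these two series, split (m , n) ∈ ℤ² by m - n mod 3 and substitute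
-- m = u + 2v + ρ, n = u - v: the form 5m² + 10n² becomes 15u² + 30v² plus linear terms.  Two
-- of the residue classes give the two summands of L times Σ_v (-1)^v q^(30v²+10v), which is
-- (q^20; q^20)_∞, and the third vanishes under v ↦ -1-v.  So L is a product, and comparing it
-- with the right-hand side is a matter of dissecting (q^a; q^b)_∞ by residues of the index.
-- All identities are proved modulo q^N for every N.
module Submission where

open import Defs
open import Algebra.Bundles using (CommutativeSemiring)
open import Algebra.Structures using (IsCommutativeSemiring)
import Algebra.Solver.CommutativeMonoid as MonoidSolver
open import Data.Nat as ℕ using (ℕ; zero; suc; pred; _∸_; _≤_; _<_; z≤n; s≤s)
import Data.Nat.Properties as ℕₚ
open import Data.Nat.Divisibility using (_∣_; _∣?_; _∣0; divides; ∣m+n∣m⇒∣n; ∣m∣n⇒∣m+n; ∣-refl; ∣⇒≤)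
open import Data.Nat.DivMod using (_/_; _%_; m≡m%n+[m/n]*n; m%n<n; %-distribˡ-*; [m+kn]%n≡m%n; [m+n]%n≡m%n; +-distrib-/-∣ʳ; m*n/n≡m)
import Data.Nat.Tactic.RingSolver as ℕ-Solver
open import Data.Integer as ℤ using (ℤ; +_; -_; -[1+_]; _⊖_; ∣_∣; 0ℤ; 1ℤ; -1ℤ)
import Data.Integer.Properties as ℤₚ
open import Data.Integer.DivMod using (_/ℕ_; _%ℕ_; a≡a%ℕn+[a/ℕn]*n; n%ℕd<d)
open import Data.Integer.Tactic.RingSolver using (solve-∀)
open import Algebra.Properties.AbelianGroup ℤₚ.+-0-abelianGroup using (∙-cancelʳ)
open import Data.Fin using (Fin)
open import Data.Fin.Patterns using (0F; 1F; 2F)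
open import Data.List using (List; []; _∷_; _++_; map; filter; upTo; allFin; cartesianProduct)
open import Data.List.Membership.Propositional using (_∈_)
open import Data.List.Membership.Propositional.Properties using (∈-map⁺; ∈-map⁻; ∈-filter⁺; ∈-filter⁻; ∈-upTo⁺; ∈-++⁺ˡ; ∈-++⁺ʳ; ∈-cartesianProduct⁺; ∈-allFin)
open import Data.List.Membership.Propositional.Properties.WithK using (unique∧set⇒bag)
open import Data.List.Properties using (upTo-∷ʳ)
open import Data.List.Relation.Binary.BagAndSetEquality using (∼bag⇒↭)
open import Data.List.Relation.Binary.Permutation.Propositional using (_↭_)
import Data.List.Relation.Binary.Permutation.Propositional as Perm
open import Data.List.Relation.Unary.Unique.Propositional using (Unique)
import Data.List.Relation.Unary.Unique.Propositional.Properties as Unique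
open import Data.Product using (_,_; _×_; ∃; proj₁; proj₂)
open import Data.Sum using (_⊎_; inj₁; inj₂)
open import Data.Sum.Properties using (inj₁-injective; inj₂-injective)
open import Function using (_∘_; mk⇔)
open import Level using (0ℓ)
open import Relation.Nullary using (¬_; ¬?; yes; no; contradiction)
open import Relation.Nullary.Decidable using (from-no)
open import Relation.Unary using (Decidable)
open import Relation.Binary.Structures using (IsEquivalence)
open import Relation.Binary.PropositionalEquality using (_≡_; _≢_; refl; sym; trans; cong; cong₂; subst; subst₂; module ≡-Reasoning)
import Relation.Binary.Reasoning.Setoid as SetoidReasoning

-- Finite sums of integers

-- The substitution comes from diagonalising: with m = u + 2v and n = u - v the cross terms of 5m²
-- and 10n² cancel. Its determinant is -3, so it reaches a third of the lattice, hence three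
-- classes. The second series and the extra factor (q^20; q^20)_∞ replace the two-variable quintuple
-- product identity and its functional equations in z: everything stays a series in q alone, and the
-- only input is the triple product, itself a limit of Rothe's finite q-binomial identity. The
-- obstacle is that the sums run over ℤ. Each theta series is cut off at |m| ≤ N, a box that the
-- substitution does not preserve. Boxes are therefore never matched: two finite lists give the same
-- coefficient as soon as both contain every index with a nonzero term, and the growth of the
-- exponents bounds those indices. Division is avoided as well, by cancelling Pochhammer products
-- that have explicit inverses modulo q^N.

sumTo-cong : ∀ {f g} n → (∀ i → i < n → f i ≡ g i) → sumTo f n ≡ sumTo g n
sumTo-cong zero    _  = refl
sumTo-cong (suc n) eq =
  cong₂ ℤ._+_ (sumTo-cong n λ i i<n → eq i (ℕₚ.m<n⇒m<1+n i<n)) (eq n ℕₚ.≤-refl)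

sumTo-front : ∀ f n → sumTo f (suc n) ≡ f 0 ℤ.+ sumTo (f ∘ suc) n
sumTo-front f zero    = ℤₚ.+-comm 0ℤ (f 0)
sumTo-front f (suc n) =
  trans (cong (ℤ._+ f (suc n)) (sumTo-front f n)) (ℤₚ.+-assoc (f 0) _ _)

sumTo-+ : ∀ f g n → sumTo (λ i → f i ℤ.+ g i) n ≡ sumTo f n ℤ.+ sumTo g n
sumTo-+ f g zero    = refl
sumTo-+ f g (suc n) rewrite sumTo-+ f g n =
  interchange (sumTo f n) (sumTo g n) (f n) (g n)
  where
  interchange : ∀ a b c d → a ℤ.+ b ℤ.+ (c ℤ.+ d) ≡ a ℤ.+ c ℤ.+ (b ℤ.+ d)
  interchange = solve-∀

sumTo-0 : ∀ n → sumTo (λ _ → 0ℤ) n ≡ 0ℤ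
sumTo-0 zero    = refl
sumTo-0 (suc n) rewrite sumTo-0 n = refl

-- The semiring of power series

tail : PS → PS
tail f n = f (suc n)

infixr 8 _•_
_•_ : ℤ → PS → PS
(c • f) n = c ℤ.* f n

zeroPS : PS
zeroPS _ = 0ℤ

-- Peeling off the first coefficient of f reduces every law of ⋆ to an induction on n.
⋆-suc : ∀ f g n → (f ⋆ g) (suc n) ≡ f 0 ℤ.* g (suc n) ℤ.+ (tail f ⋆ g) n
⋆-suc f g n = sumTo-front (λ i → f i ℤ.* g (suc n ∸ i)) (suc n)

⋆-zero : ∀ f g → (f ⋆ g) 0 ≡ f 0 ℤ.* g 0
⋆-zero f g = ℤₚ.+-identityˡ _

⋆-cong : ∀ {f f′ g g′} n → (∀ i → i ≤ n → f i ≡ f′ i) → (∀ i → i ≤ n → g i ≡ g′ i) →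
         (f ⋆ g) n ≡ (f′ ⋆ g′) n
⋆-cong n p q = sumTo-cong (suc n)
  λ { i (s≤s i≤n) → cong₂ ℤ._*_ (p i i≤n) (q (n ∸ i) (ℕₚ.m∸n≤m n i)) }

⋆-congˡ : ∀ {f f′} g n → (∀ i → f i ≡ f′ i) → (f ⋆ g) n ≡ (f′ ⋆ g) n
⋆-congˡ g n p = ⋆-cong {g = g} {g} n (λ i _ → p i) λ _ _ → refl

⋆-zeroˡ : ∀ g n → (zeroPS ⋆ g) n ≡ 0ℤ
⋆-zeroˡ g n = sumTo-0 (suc n)

⋆-distribʳ : ∀ h f g n → ((λ i → f i ℤ.+ g i) ⋆ h) n ≡ (f ⋆ h) n ℤ.+ (g ⋆ h) n
⋆-distribʳ h f g n = trans
  (sumTo-cong (suc n) λ i _ → ℤₚ.*-distribʳ-+ (h (n ∸ i)) (f i) (g i))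
  (sumTo-+ _ _ (suc n))

⋆-•ˡ : ∀ c f g n → ((c • f) ⋆ g) n ≡ c ℤ.* (f ⋆ g) n
⋆-•ˡ c f g zero
  rewrite ⋆-zero (c • f) g | ⋆-zero f g = ℤₚ.*-assoc c (f 0) (g 0)
⋆-•ˡ c f g (suc n)
  rewrite ⋆-suc (c • f) g n | ⋆-suc f g n | ⋆-•ˡ c (tail f) g n = lemma c (f 0) (g (suc n)) _
  where
  lemma : ∀ c x y z → c ℤ.* x ℤ.* y ℤ.+ c ℤ.* z ≡ c ℤ.* (x ℤ.* y ℤ.+ z)
  lemma = solve-∀

⋆-identityˡ : ∀ f n → (onePS ⋆ f) n ≡ f n
⋆-identityˡ f zero = trans (⋆-zero onePS f) (ℤₚ.*-identityˡ (f 0))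
⋆-identityˡ f (suc n)
  rewrite ⋆-suc onePS f n | ⋆-zeroˡ f n =
  trans (ℤₚ.+-identityʳ _) (ℤₚ.*-identityˡ (f (suc n)))

-- Peeling both series leaves the product of the two tails two degrees lower, so degrees 0 and 1 are
-- base cases.
⋆-comm : ∀ f g n → (f ⋆ g) n ≡ (g ⋆ f) n
⋆-comm f g zero
  rewrite ⋆-zero f g | ⋆-zero g f = ℤₚ.*-comm (f 0) (g 0)
⋆-comm f g (suc zero)
  rewrite ⋆-suc f g 0 | ⋆-suc g f 0 | ⋆-zero (tail f) g | ⋆-zero (tail g) f =
  lemma (f 0) (f 1) (g 0) (g 1)
  where
  lemma : ∀ a b c d → a ℤ.* d ℤ.+ b ℤ.* c ≡ c ℤ.* b ℤ.+ d ℤ.* a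
  lemma = solve-∀
⋆-comm f g (suc (suc n)) = begin
  (f ⋆ g) (suc (suc n))
    ≡⟨ ⋆-suc f g (suc n) ⟩
  f 0 ℤ.* g (suc (suc n)) ℤ.+ (tail f ⋆ g) (suc n)
    ≡⟨ cong (λ x → f 0 ℤ.* g (suc (suc n)) ℤ.+ x) (trans (⋆-comm (tail f) g (suc n)) (⋆-suc g (tail f) n)) ⟩
  f 0 ℤ.* g (suc (suc n)) ℤ.+ (g 0 ℤ.* f (suc (suc n)) ℤ.+ (tail g ⋆ tail f) n)
    ≡⟨ swap (f 0 ℤ.* g (suc (suc n))) (g 0 ℤ.* f (suc (suc n))) _ ⟩
  g 0 ℤ.* f (suc (suc n)) ℤ.+ (f 0 ℤ.* g (suc (suc n)) ℤ.+ (tail g ⋆ tail f) n)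
    ≡⟨ cong (λ x → g 0 ℤ.* f (suc (suc n)) ℤ.+ (f 0 ℤ.* g (suc (suc n)) ℤ.+ x)) (⋆-comm (tail g) (tail f) n) ⟩
  g 0 ℤ.* f (suc (suc n)) ℤ.+ (f 0 ℤ.* g (suc (suc n)) ℤ.+ (tail f ⋆ tail g) n)
    ≡⟨ cong (λ x → g 0 ℤ.* f (suc (suc n)) ℤ.+ x) (trans (⋆-comm (tail g) f (suc n)) (⋆-suc f (tail g) n)) ⟨
  g 0 ℤ.* f (suc (suc n)) ℤ.+ (tail g ⋆ f) (suc n)
    ≡⟨ ⋆-suc g f (suc n) ⟨
  (g ⋆ f) (suc (suc n)) ∎
  where
  open ≡-Reasoning
  swap : ∀ a b c → a ℤ.+ (b ℤ.+ c) ≡ b ℤ.+ (a ℤ.+ c)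
  swap = solve-∀

⋆-assoc : ∀ f g h n → ((f ⋆ g) ⋆ h) n ≡ (f ⋆ (g ⋆ h)) n
⋆-assoc f g h zero
  rewrite ⋆-zero (f ⋆ g) h | ⋆-zero f (g ⋆ h) | ⋆-zero f g | ⋆-zero g h =
  ℤₚ.*-assoc (f 0) (g 0) (h 0)
⋆-assoc f g h (suc n) = begin
  ((f ⋆ g) ⋆ h) (suc n)
    ≡⟨ ⋆-suc (f ⋆ g) h n ⟩
  (f ⋆ g) 0 ℤ.* h (suc n) ℤ.+ (tail (f ⋆ g) ⋆ h) n
    ≡⟨ cong₂ ℤ._+_ (cong (ℤ._* h (suc n)) (⋆-zero f g)) expand ⟩
  f 0 ℤ.* g 0 ℤ.* h (suc n) ℤ.+ (f 0 ℤ.* (tail g ⋆ h) n ℤ.+ (tail f ⋆ (g ⋆ h)) n)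
    ≡⟨ lemma (f 0) (g 0) (h (suc n)) _ _ ⟩
  f 0 ℤ.* (g 0 ℤ.* h (suc n) ℤ.+ (tail g ⋆ h) n) ℤ.+ (tail f ⋆ (g ⋆ h)) n
    ≡⟨ cong (λ x → f 0 ℤ.* x ℤ.+ (tail f ⋆ (g ⋆ h)) n) (⋆-suc g h n) ⟨
  f 0 ℤ.* (g ⋆ h) (suc n) ℤ.+ (tail f ⋆ (g ⋆ h)) n
    ≡⟨ ⋆-suc f (g ⋆ h) n ⟨
  (f ⋆ (g ⋆ h)) (suc n) ∎
  where
  open ≡-Reasoning
  lemma : ∀ a b c d e → a ℤ.* b ℤ.* c ℤ.+ (a ℤ.* d ℤ.+ e) ≡ a ℤ.* (b ℤ.* c ℤ.+ d) ℤ.+ e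
  lemma = solve-∀
  expand : (tail (f ⋆ g) ⋆ h) n ≡ f 0 ℤ.* (tail g ⋆ h) n ℤ.+ (tail f ⋆ (g ⋆ h)) n
  expand = trans (⋆-congˡ h n (⋆-suc f g))
    (trans (⋆-distribʳ h (f 0 • tail g) (tail f ⋆ g) n)
      (cong₂ ℤ._+_ (⋆-•ˡ (f 0) (tail g) h n) (⋆-assoc (tail f) g h n)))

-- Congruence modulo q^N

infix 4 _≈[_]_
-- A record, so that the series and the modulus can be inferred from a proof.
record _≈[_]_ (f : PS) (N : ℕ) (g : PS) : Set where
  constructor modulo
  field coeff : ∀ n → n < N → f n ≡ g n
open _≈[_]_ public

exact : ∀ {N f g} → (∀ n → f n ≡ g n) → f ≈[ N ] g
exact eq = modulo λ n _ → eq n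

weaken : ∀ {M N f g} → M ≤ N → f ≈[ N ] g → f ≈[ M ] g
weaken M≤N p = modulo λ n n<M → coeff p n (ℕₚ.≤-trans n<M M≤N)

-- Opaque copies of the operations: otherwise unification at the function type PS
-- unfolds them to coefficients and fails to find the factors.
infixl 6 _⊕_
infixl 7 _⊗_
opaque
  _⊕_ : PS → PS → PS
  (f ⊕ g) n = f n ℤ.+ g n

  _⊗_ : PS → PS → PS
  _⊗_ = _⋆_

  ⊕-coeff : ∀ f g n → (f ⊕ g) n ≡ f n ℤ.+ g n
  ⊕-coeff f g n = refl

  ⊗-coeff : ∀ f g n → (f ⊗ g) n ≡ (f ⋆ g) n
  ⊗-coeff f g n = refl

  ≈-isEquivalence : ∀ N → IsEquivalence _≈[ N ]_
  ≈-isEquivalence N = record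
    { refl = exact λ _ → refl
    ; sym = λ p → modulo λ n n<N → sym (coeff p n n<N)
    ; trans = λ p q → modulo λ n n<N → trans (coeff p n n<N) (coeff q n n<N) }

  truncated-isCommutativeSemiring : ∀ N → IsCommutativeSemiring _≈[ N ]_ _⊕_ _⊗_ zeroPS onePS
  truncated-isCommutativeSemiring N = record
    { isSemiring = record
      { isSemiringWithoutAnnihilatingZero = record
        { +-isCommutativeMonoid = record
          { isMonoid = record
            { isSemigroup = record
              { isMagma = record
                { isEquivalence = ≈-isEquivalence N
                ; ∙-cong = λ p q → modulo λ n n<N → cong₂ ℤ._+_ (coeff p n n<N) (coeff q n n<N) }
              ; assoc = λ f g h → exact λ n → ℤₚ.+-assoc (f n) (g n) (h n) }
            ; identity = (λ f → exact λ n → ℤₚ.+-identityˡ (f n))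
                       , (λ f → exact λ n → ℤₚ.+-identityʳ (f n)) }
          ; comm = λ f g → exact λ n → ℤₚ.+-comm (f n) (g n) }
        ; *-cong = λ p q → modulo λ n n<N → ⋆-cong n
            (λ i i≤n → coeff p i (ℕₚ.≤-<-trans i≤n n<N))
            (λ i i≤n → coeff q i (ℕₚ.≤-<-trans i≤n n<N))
        ; *-assoc = λ f g h → exact (⋆-assoc f g h)
        ; *-identity = (λ f → exact (⋆-identityˡ f))
                     , (λ f → exact λ n → trans (⋆-comm f onePS n) (⋆-identityˡ f n))
        ; distrib = (λ h f g → exact λ n → trans (⋆-comm h (f ⊕ g) n)
                      (trans (⋆-distribʳ h f g n)
                        (cong₂ ℤ._+_ (⋆-comm f h n) (⋆-comm g h n))))
                  , (λ h f g → exact (⋆-distribʳ h f g)) }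
      ; zero = (λ f → exact (⋆-zeroˡ f))
             , (λ f → exact λ n → trans (⋆-comm f zeroPS n) (⋆-zeroˡ f n)) }
    ; *-comm = λ f g → exact (⋆-comm f g) }

truncated : ℕ → CommutativeSemiring 0ℓ 0ℓ
truncated N = record { isCommutativeSemiring = truncated-isCommutativeSemiring N }

module Ring {N : ℕ} = CommutativeSemiring (truncated N)
module ≈-Reasoning {N : ℕ} = SetoidReasoning (Ring.setoid {N})

-- Monomials

-- Recursion on both arguments makes `tail (mono c (suc e))` compute to `mono c e`, which fits the
-- peeling in `⋆-suc`.
mono : ℤ → ℕ → PS
mono c zero    zero    = c
mono c zero    (suc n) = 0ℤ
mono c (suc e) zero    = 0ℤ
mono c (suc e) (suc n) = mono c e n

mono-off : ∀ c e n → e ≢ n → mono c e n ≡ 0ℤ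
mono-off c zero    zero    e≢n = contradiction refl e≢n
mono-off c zero    (suc n) e≢n = refl
mono-off c (suc e) zero    e≢n = refl
mono-off c (suc e) (suc n) e≢n = mono-off c e n (e≢n ∘ cong suc)

mono-on : ∀ c e → mono c e e ≡ c
mono-on c zero    = refl
mono-on c (suc e) = mono-on c e

mono-degree : ∀ c e {n} → mono c e n ≢ 0ℤ → e ≡ n
mono-degree c e {n} ≢0 with e ℕ.≟ n
... | yes e≡n = e≡n
... | no  e≢n = contradiction (mono-off c e n e≢n) ≢0

mono-neg : ∀ c e n → mono (- c) e n ≡ - mono c e n
mono-neg c zero    zero    = refl
mono-neg c zero    (suc n) = refl
mono-neg c (suc e) zero    = refl
mono-neg c (suc e) (suc n) = mono-neg c e n

mono-0-⋆ : ∀ c f n → (mono c 0 ⋆ f) n ≡ c ℤ.* f n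
mono-0-⋆ c f zero    = ⋆-zero (mono c 0) f
mono-0-⋆ c f (suc n) = trans (⋆-suc (mono c 0) f n)
  (trans (cong (λ x → c ℤ.* f (suc n) ℤ.+ x) (⋆-zeroˡ f n)) (ℤₚ.+-identityʳ _))

mono-suc-⋆-zero : ∀ c e f → (mono c (suc e) ⋆ f) 0 ≡ 0ℤ
mono-suc-⋆-zero c e f = ⋆-zero (mono c (suc e)) f

mono-suc-⋆-suc : ∀ c e f n → (mono c (suc e) ⋆ f) (suc n) ≡ (mono c e ⋆ f) n
mono-suc-⋆-suc c e f n = trans (⋆-suc (mono c (suc e)) f n) (ℤₚ.+-identityˡ _)

mono-⋆-below : ∀ c e f n → n < e → (mono c e ⋆ f) n ≡ 0ℤ
mono-⋆-below c (suc e) f zero    _         = mono-suc-⋆-zero c e f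
mono-⋆-below c (suc e) f (suc n) (s≤s n<e) =
  trans (mono-suc-⋆-suc c e f n) (mono-⋆-below c e f n n<e)

mono-⋆-shift : ∀ c e f n → (mono c e ⋆ f) (e ℕ.+ n) ≡ c ℤ.* f n
mono-⋆-shift c zero    f n = mono-0-⋆ c f n
mono-⋆-shift c (suc e) f n =
  trans (mono-suc-⋆-suc c e f (e ℕ.+ n)) (mono-⋆-shift c e f n)

mono-⋆-mono : ∀ c e c′ e′ n → (mono c e ⋆ mono c′ e′) n ≡ mono (c ℤ.* c′) (e ℕ.+ e′) n
mono-⋆-mono c zero c′ e′ n = trans (mono-0-⋆ c (mono c′ e′) n) (scale e′ n)
  where
  scale : ∀ e n → c ℤ.* mono c′ e n ≡ mono (c ℤ.* c′) e n
  scale zero    zero    = refl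
  scale zero    (suc n) = ℤₚ.*-zeroʳ c
  scale (suc e) zero    = ℤₚ.*-zeroʳ c
  scale (suc e) (suc n) = scale e n
mono-⋆-mono c (suc e) c′ e′ zero    = mono-suc-⋆-zero c e (mono c′ e′)
mono-⋆-mono c (suc e) c′ e′ (suc n) =
  trans (mono-suc-⋆-suc c e (mono c′ e′) n) (mono-⋆-mono c e c′ e′ n)

mono-* : ∀ {N} c e c′ e′ → mono c e ⊗ mono c′ e′ ≈[ N ] mono (c ℤ.* c′) (e ℕ.+ e′)
mono-* c e c′ e′ = exact λ n → trans (⊗-coeff (mono c e) (mono c′ e′) n) (mono-⋆-mono c e c′ e′ n)

mono-1 : ∀ n → mono 1ℤ 0 n ≡ onePS n
mono-1 zero    = refl
mono-1 (suc n) = refl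

mono-vanish : ∀ {N} c e → N ≤ e → mono c e ≈[ N ] zeroPS
mono-vanish c e N≤e =
  modulo λ n n<N → mono-off c e n (ℕₚ.<⇒≢ (ℕₚ.<-≤-trans n<N N≤e) ∘ sym)

-- Multiplication by q^e gains e orders of precision. The triple product needs this where a binomial
-- coefficient is known only to an order below N.
mono-raise : ∀ {j N f g} c e → N ≤ e ℕ.+ j → f ≈[ j ] g →
               mono c e ⊗ f ≈[ N ] mono c e ⊗ g
mono-raise {j} {N} {f} {g} c e N≤e+j f≈g = modulo λ n n<N →
  trans (⊗-coeff (mono c e) f n) (trans (go n n<N (ℕₚ.<-≤-connex n e)) (sym (⊗-coeff (mono c e) g n)))
  where
  go : ∀ n → n < N → n < e ⊎ e ≤ n → (mono c e ⋆ f) n ≡ (mono c e ⋆ g) n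
  go n n<N (inj₁ n<e) = trans (mono-⋆-below c e f n n<e) (sym (mono-⋆-below c e g n n<e))
  go n n<N (inj₂ e≤n) with ℕₚ.m≤n⇒∃[o]m+o≡n e≤n
  ... | k , refl = trans (mono-⋆-shift c e f k)
    (trans (cong (c ℤ.*_) (coeff f≈g k (ℕₚ.+-cancelˡ-< e k j (ℕₚ.<-≤-trans n<N N≤e+j))))
      (sym (mono-⋆-shift c e g k)))

-- Linear factors and their geometric inverses

factor : ℤ → ℕ → PS
factor c e = onePS ⊕ mono c e

oneMinus-factor : ∀ {N} k → oneMinus k ≈[ N ] factor -1ℤ k
oneMinus-factor k = exact λ n → trans (go k n) (sym (⊕-coeff onePS (mono -1ℤ k) n))
  where
  go : ∀ k n → oneMinus k n ≡ onePS n ℤ.+ mono -1ℤ k n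
  go zero    zero = refl
  go (suc k) zero = refl
  go zero    (suc n) = refl
  go (suc k) (suc n) with suc n ℕ.≟ suc k
  ... | yes refl = sym (trans (ℤₚ.+-identityˡ _) (mono-on -1ℤ n))
  ... | no  n≢k  = sym (trans (ℤₚ.+-identityˡ _) (mono-off -1ℤ k n (n≢k ∘ cong suc ∘ sym)))

factor-one : ∀ {N} c e → N ≤ e → factor c e ≈[ N ] onePS
factor-one c e N≤e = Ring.trans (Ring.+-cong Ring.refl (mono-vanish c e N≤e)) (Ring.+-identityʳ onePS)

geom-periodic : ∀ k n → geom k (k ℕ.+ n) ≡ geom k n
geom-periodic k n with k ∣? (k ℕ.+ n) | k ∣? n
... | yes _ | yes _ = refl
... | no  _ | no  _ = refl
... | yes p | no ¬q = contradiction (∣m+n∣m⇒∣n p ∣-refl) ¬q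
... | no ¬p | yes q = contradiction (∣m∣n⇒∣m+n ∣-refl q) ¬p

geom-below : ∀ k n → n < k → geom k n ≡ onePS n
geom-below k zero n<k with k ∣? 0
... | yes _ = refl
... | no ¬p = contradiction (k ∣0) ¬p
geom-below k (suc n) n<k with k ∣? suc n
... | yes p = contradiction (∣⇒≤ p) (ℕₚ.<⇒≱ n<k)
... | no  _ = refl

-- The coefficients of the geometric series have period `suc k` and begin like those of 1, so
-- subtracting the shifted copy leaves only the initial block.
oneMinus-geom : ∀ {N} k → oneMinus (suc k) ⊗ geom (suc k) ≈[ N ] onePS
oneMinus-geom k = Ring.trans (Ring.*-cong (oneMinus-factor (suc k)) Ring.refl)
  (Ring.trans (Ring.distribʳ (geom (suc k)) onePS (mono -1ℤ (suc k)))
    (Ring.trans (Ring.+-cong (Ring.*-identityˡ (geom (suc k))) Ring.refl)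
      (exact λ n → trans (⊕-coeff (geom (suc k)) (mono -1ℤ (suc k) ⊗ geom (suc k)) n)
        (trans (cong (λ x → geom (suc k) n ℤ.+ x) (⊗-coeff (mono -1ℤ (suc k)) (geom (suc k)) n))
          (go n (ℕₚ.<-≤-connex n (suc k)))))))
  where
  go : ∀ n → n < suc k ⊎ suc k ≤ n →
       geom (suc k) n ℤ.+ (mono -1ℤ (suc k) ⋆ geom (suc k)) n ≡ onePS n
  go n (inj₁ n<k) = trans (cong₂ ℤ._+_ (geom-below (suc k) n n<k)
    (mono-⋆-below -1ℤ (suc k) (geom (suc k)) n n<k)) (ℤₚ.+-identityʳ _)
  go n (inj₂ k≤n) with ℕₚ.m≤n⇒∃[o]m+o≡n k≤n
  ... | m , refl = trans (cong₂ ℤ._+_ (geom-periodic (suc k) m)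
    (trans (mono-⋆-shift -1ℤ (suc k) (geom (suc k)) m) (ℤₚ.-1*i≡-i (geom (suc k) m))))
      (ℤₚ.+-inverseʳ (geom (suc k) m))

-- Finite and infinite products

∏ : (ℕ → PS) → ℕ → PS
∏ f zero    = onePS
∏ f (suc n) = ∏ f n ⊗ f n

module _ {N : ℕ} where
  open Ring {N} using (*-cong; *-assoc; *-identityˡ; *-identityʳ; setoid)
  open SetoidReasoning setoid
  open import Algebra.Properties.CommutativeSemigroup (Ring.*-commutativeSemigroup {N}) using (interchange)

  prodTo-∏ : ∀ f n → prodTo f n ≈[ N ] ∏ f n
  prodTo-∏ f zero    = Ring.refl
  prodTo-∏ f (suc n) = Ring.trans
    (exact λ i → sym (⊗-coeff (prodTo f n) (f n) i)) (*-cong (prodTo-∏ f n) Ring.refl)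

  ∏-cong : ∀ {f g} n → (∀ i → f i ≈[ N ] g i) → ∏ f n ≈[ N ] ∏ g n
  ∏-cong zero    _  = Ring.refl
  ∏-cong (suc n) eq = *-cong (∏-cong n eq) (eq n)

  ∏-one : ∀ n → ∏ (λ _ → onePS) n ≈[ N ] onePS
  ∏-one zero    = Ring.refl
  ∏-one (suc n) = Ring.trans (*-identityʳ _) (∏-one n)

  ∏-⊗ : ∀ f g n → ∏ (λ i → f i ⊗ g i) n ≈[ N ] ∏ f n ⊗ ∏ g n
  ∏-⊗ f g zero    = Ring.sym (*-identityˡ onePS)
  ∏-⊗ f g (suc n) = Ring.trans (*-cong (∏-⊗ f g n) Ring.refl)
    (interchange (∏ f n) (∏ g n) (f n) (g n))

  ∏-split : ∀ f m n → ∏ f (m ℕ.+ n) ≈[ N ] ∏ f m ⊗ ∏ (λ i → f (m ℕ.+ i)) n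
  ∏-split f m zero rewrite ℕₚ.+-identityʳ m = Ring.sym (*-identityʳ _)
  ∏-split f m (suc n) rewrite ℕₚ.+-suc m n =
    Ring.trans (*-cong (∏-split f m n) Ring.refl) (*-assoc _ _ _)

  -- Each block of `s` consecutive factors contributes one factor to every residue class modulo `s`.
  ∏-dissect : ∀ f s K →
    ∏ f (K ℕ.* s) ≈[ N ] ∏ (λ j → ∏ (λ i → f (i ℕ.* s ℕ.+ j)) K) s
  ∏-dissect f s zero    = Ring.sym (∏-one s)
  ∏-dissect f s (suc K) = begin
    ∏ f (s ℕ.+ K ℕ.* s)
      ≡⟨ cong (∏ f) (ℕₚ.+-comm s (K ℕ.* s)) ⟩
    ∏ f (K ℕ.* s ℕ.+ s)
      ≈⟨ ∏-split f (K ℕ.* s) s ⟩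
    ∏ f (K ℕ.* s) ⊗ ∏ (λ j → f (K ℕ.* s ℕ.+ j)) s
      ≈⟨ *-cong (∏-dissect f s K) Ring.refl ⟩
    ∏ (λ j → ∏ (λ i → f (i ℕ.* s ℕ.+ j)) K) s ⊗ ∏ (λ j → f (K ℕ.* s ℕ.+ j)) s
      ≈⟨ ∏-⊗ _ _ s ⟨
    ∏ (λ j → ∏ (λ i → f (i ℕ.* s ℕ.+ j)) (suc K)) s ∎

  -- Factors of index at least N are 1 modulo q^N, so every cutoff from N on represents the infinite
  -- product.
  ∏-stable : ∀ {f} → (∀ i → f i ≈[ suc i ] onePS) → ∀ {m n} → N ≤ m → N ≤ n →
                  ∏ f m ≈[ N ] ∏ f n
  ∏-stable {f} f≈1 {m} {n} N≤m N≤n = Ring.trans (reduce N≤m) (Ring.sym (reduce N≤n))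
    where
    reduce : ∀ {m} → N ≤ m → ∏ f m ≈[ N ] ∏ f N
    reduce N≤m with ℕₚ.m≤n⇒∃[o]m+o≡n N≤m
    ... | k , refl = begin
      ∏ f (N ℕ.+ k)
        ≈⟨ ∏-split f N k ⟩
      ∏ f N ⊗ ∏ (λ i → f (N ℕ.+ i)) k
        ≈⟨ *-cong Ring.refl (Ring.trans
             (∏-cong k λ i → weaken (ℕₚ.m≤n⇒m≤1+n (ℕₚ.m≤m+n N i)) (f≈1 (N ℕ.+ i)))
             (∏-one k)) ⟩
      ∏ f N ⊗ onePS
        ≈⟨ *-identityʳ _ ⟩
      ∏ f N ∎

-- The finite Pochhammer symbol (-c q^a; q^b)_n: `c = -1` gives (q^a; q^b)_n and `c = 1` gives
-- (-q^a; q^b)_n.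
pochTo : ℤ → ℕ → ℕ → ℕ → PS
pochTo c a b = ∏ (λ i → factor c (a ℕ.+ b ℕ.* i))

exponent-bound : ∀ a b i → suc i ≤ suc a ℕ.+ suc b ℕ.* i
exponent-bound a b i = s≤s (ℕₚ.≤-trans (ℕₚ.m≤m+n i (b ℕ.* i)) (ℕₚ.m≤n+m _ a))

pochTo-stable : ∀ {N} c a b {m n} → N ≤ m → N ≤ n →
  pochTo c (suc a) (suc b) m ≈[ N ] pochTo c (suc a) (suc b) n
pochTo-stable c a b = ∏-stable λ i → factor-one c _ (exponent-bound a b i)

pochTo-dissect : ∀ {N} c a b s K → pochTo c a b (K ℕ.* s) ≈[ N ]
  ∏ (λ j → pochTo c (a ℕ.+ b ℕ.* j) (b ℕ.* s) K) s
pochTo-dissect c a b s K = Ring.trans (∏-dissect _ s K)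
  (∏-cong s λ j → ∏-cong K λ i → Ring.reflexive (cong (factor c) (index a b s i j)))
  where
  index : ∀ a b s i j → a ℕ.+ b ℕ.* (i ℕ.* s ℕ.+ j) ≡ a ℕ.+ b ℕ.* j ℕ.+ b ℕ.* s ℕ.* i
  index = ℕ-Solver.solve-∀

-- The cutoff is raised from `N` to `N * suc s`, invisibly modulo q^N, so that every residue class
-- receives exactly `N` factors.
dissection : ∀ {N} c a b s → pochTo c (suc a) (suc b) N ≈[ N ]
  ∏ (λ j → pochTo c (suc a ℕ.+ suc b ℕ.* j) (suc b ℕ.* suc s) N) (suc s)
dissection {N} c a b s = Ring.trans (pochTo-stable c a b ℕₚ.≤-refl (ℕₚ.m≤m*n N (suc s)))
  (pochTo-dissect c (suc a) (suc b) (suc s) N)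

-- The cutoff inside `poch` varies with the coefficient, so coefficient n is compared at modulus
-- `suc n`, for which both cutoffs are large enough.
poch-pochTo : ∀ {N} a b → poch (suc a) (suc b) ≈[ N ] pochTo -1ℤ (suc a) (suc b) N
poch-pochTo {N} a b = modulo λ n n<N → coeff
  (Ring.trans (Ring.trans (prodTo-∏ _ (suc n)) (∏-cong (suc n) λ i → oneMinus-factor _))
    (pochTo-stable -1ℤ a b {suc n} {N} ℕₚ.≤-refl n<N)) n ℕₚ.≤-refl

geom-one : ∀ {N} k → N ≤ k → geom k ≈[ N ] onePS
geom-one k N≤k = modulo λ n n<N → geom-below k n (ℕₚ.<-≤-trans n<N N≤k)

pochTo-geom : ∀ {N} a b n →
  pochTo -1ℤ (suc a) (suc b) n ⊗ ∏ (λ i → geom (suc a ℕ.+ suc b ℕ.* i)) n ≈[ N ] onePS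
pochTo-geom {N} a b n = begin
  pochTo -1ℤ (suc a) (suc b) n ⊗ ∏ (λ i → geom (suc a ℕ.+ suc b ℕ.* i)) n
    ≈⟨ Ring.*-cong (∏-cong n λ i → Ring.sym (oneMinus-factor _)) Ring.refl ⟩
  ∏ (λ i → oneMinus (suc a ℕ.+ suc b ℕ.* i)) n ⊗ ∏ (λ i → geom (suc a ℕ.+ suc b ℕ.* i)) n
    ≈⟨ ∏-⊗ _ _ n ⟨
  ∏ (λ i → oneMinus (suc a ℕ.+ suc b ℕ.* i) ⊗ geom (suc a ℕ.+ suc b ℕ.* i)) n
    ≈⟨ ∏-cong n (λ i → oneMinus-geom _) ⟩
  ∏ (λ _ → onePS) n
    ≈⟨ ∏-one n ⟩
  onePS ∎
  where open ≈-Reasoning {N}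

-- Truncated series have zero divisors in general; cancellation rests on the explicit inverse, a
-- product of geometric series.
pochTo-cancel : ∀ {N f g} a b n →
  f ⊗ pochTo -1ℤ (suc a) (suc b) n ≈[ N ] g ⊗ pochTo -1ℤ (suc a) (suc b) n → f ≈[ N ] g
pochTo-cancel {N} {f} {g} a b n eq = begin
  f            ≈⟨ expand f ⟩
  f ⊗ P ⊗ P⁻¹  ≈⟨ Ring.*-cong eq Ring.refl ⟩
  g ⊗ P ⊗ P⁻¹  ≈⟨ expand g ⟨
  g            ∎
  where
  open ≈-Reasoning {N}
  P P⁻¹ : PS
  P   = pochTo -1ℤ (suc a) (suc b) n
  P⁻¹ = ∏ (λ i → geom (suc a ℕ.+ suc b ℕ.* i)) n
  expand : ∀ h → h ≈[ N ] h ⊗ P ⊗ P⁻¹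
  expand h = begin
    h              ≈⟨ Ring.*-identityʳ h ⟨
    h ⊗ onePS      ≈⟨ Ring.*-cong Ring.refl (pochTo-geom a b n) ⟨
    h ⊗ (P ⊗ P⁻¹)  ≈⟨ Ring.*-assoc _ _ _ ⟨
    h ⊗ P ⊗ P⁻¹    ∎

invPoch-inverse : ∀ {N} a b → pochTo -1ℤ (suc a) (suc b) N ⊗ invPoch (suc a) (suc b) ≈[ N ] onePS
invPoch-inverse {N} a b = Ring.trans (Ring.*-cong Ring.refl invPoch-∏) (pochTo-geom a b N)
  where
  invPoch-∏ : invPoch (suc a) (suc b) ≈[ N ] ∏ (λ i → geom (suc a ℕ.+ suc b ℕ.* i)) N
  invPoch-∏ = modulo λ n n<N → coeff (Ring.trans (prodTo-∏ _ (suc n))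
    (∏-stable {suc n} (λ i → geom-one _ (exponent-bound a b i)) {suc n} {N} ℕₚ.≤-refl n<N)) n ℕₚ.≤-refl

-- The truncated series are used as a semiring, so subtraction enters only through this relation.
mono-cancel : ∀ {N} e → mono 1ℤ e ⊕ mono -1ℤ e ≈[ N ] zeroPS
mono-cancel e = exact λ n → trans (⊕-coeff (mono 1ℤ e) (mono -1ℤ e) n)
  (trans (cong (λ x → mono 1ℤ e n ℤ.+ x) (mono-neg 1ℤ e n)) (ℤₚ.+-inverseʳ (mono 1ℤ e n)))

factor-conjugate : ∀ {N} e → factor 1ℤ e ⊗ factor -1ℤ e ≈[ N ] factor -1ℤ (e ℕ.+ e)
factor-conjugate {N} e = begin
  factor 1ℤ e ⊗ factor -1ℤ e
    ≈⟨ solve 2 (λ x y → (con 1 :+ x) :* (con 1 :+ y) := con 1 :+ (x :+ y) :+ x :* y)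
         Ring.refl (mono 1ℤ e) (mono -1ℤ e) ⟩
  onePS ⊕ (mono 1ℤ e ⊕ mono -1ℤ e) ⊕ mono 1ℤ e ⊗ mono -1ℤ e
    ≈⟨ Ring.+-cong (Ring.+-cong Ring.refl (mono-cancel e)) (mono-* 1ℤ e -1ℤ e) ⟩
  onePS ⊕ zeroPS ⊕ mono -1ℤ (e ℕ.+ e)
    ≈⟨ Ring.+-cong (Ring.+-identityʳ onePS) Ring.refl ⟩
  factor -1ℤ (e ℕ.+ e) ∎
  where
  open ≈-Reasoning {N}
  open import Algebra.Solver.Ring.NaturalCoefficients.Default (truncated N)

pochTo-conjugate : ∀ {N} a b K →
  pochTo 1ℤ a b K ⊗ pochTo -1ℤ a b K ≈[ N ] pochTo -1ℤ (a ℕ.+ a) (b ℕ.+ b) K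
pochTo-conjugate a b K = Ring.trans (Ring.sym (∏-⊗ _ _ K))
  (∏-cong K λ i → Ring.trans (factor-conjugate (a ℕ.+ b ℕ.* i))
    (Ring.reflexive (cong (factor -1ℤ) (double a b i))))
  where
  double : ∀ a b i → a ℕ.+ b ℕ.* i ℕ.+ (a ℕ.+ b ℕ.* i) ≡ a ℕ.+ a ℕ.+ (b ℕ.+ b) ℕ.* i
  double = ℕ-Solver.solve-∀

-- Finite sums and Gaussian binomial coefficients

∑ : (ℕ → PS) → ℕ → PS
∑ f zero    = zeroPS
∑ f (suc n) = ∑ f n ⊕ f n

module _ {N : ℕ} where
  open Ring {N} using (+-cong; +-comm; +-assoc; +-identityˡ; zeroˡ; distribʳ; setoid)
  open SetoidReasoning setoid
  open import Algebra.Properties.CommutativeSemigroup (CommutativeSemiring.+-commutativeSemigroup (truncated N)) using (interchange)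

  ∑-cong : ∀ {f g} n → (∀ i → i < n → f i ≈[ N ] g i) → ∑ f n ≈[ N ] ∑ g n
  ∑-cong zero    _  = Ring.refl
  ∑-cong (suc n) eq = +-cong (∑-cong n λ i i<n → eq i (ℕₚ.m<n⇒m<1+n i<n)) (eq n ℕₚ.≤-refl)

  ∑-⊕ : ∀ f g n → ∑ (λ i → f i ⊕ g i) n ≈[ N ] ∑ f n ⊕ ∑ g n
  ∑-⊕ f g zero    = Ring.sym (+-identityˡ zeroPS)
  ∑-⊕ f g (suc n) = Ring.trans (+-cong (∑-⊕ f g n) Ring.refl)
    (interchange (∑ f n) (∑ g n) (f n) (g n))

  ∑-⊗ : ∀ f h n → ∑ (λ i → f i ⊗ h) n ≈[ N ] ∑ f n ⊗ h
  ∑-⊗ f h zero    = Ring.sym (zeroˡ h)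
  ∑-⊗ f h (suc n) = Ring.trans (+-cong (∑-⊗ f h n) Ring.refl) (Ring.sym (distribʳ h (∑ f n) (f n)))

  ∑-front : ∀ f n → ∑ f (suc n) ≈[ N ] f 0 ⊕ ∑ (f ∘ suc) n
  ∑-front f zero    = +-comm zeroPS (f 0)
  ∑-front f (suc n) = Ring.trans (+-cong (∑-front f n) Ring.refl) (+-assoc _ _ _)

  ∑-reverse : ∀ f n → ∑ f (suc n) ≈[ N ] ∑ (λ k → f (n ∸ k)) (suc n)
  ∑-reverse f zero    = Ring.refl
  ∑-reverse f (suc n) = begin
    ∑ f (suc n) ⊕ f (suc n)                      ≈⟨ +-comm _ _ ⟩
    f (suc n) ⊕ ∑ f (suc n)                      ≈⟨ +-cong Ring.refl (∑-reverse f n) ⟩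
    f (suc n) ⊕ ∑ (λ k → f (n ∸ k)) (suc n)      ≈⟨ ∑-front (λ k → f (suc n ∸ k)) (suc n) ⟨
    ∑ (λ k → f (suc n ∸ k)) (suc (suc n))        ∎

-- The binomial coefficient of base q^d.
gauss : ℕ → ℕ → ℕ → PS
gauss d M       zero    = onePS
gauss d zero    (suc k) = zeroPS
gauss d (suc M) (suc k) = gauss d M (suc k) ⊕ mono 1ℤ (d ℕ.* (M ∸ k)) ⊗ gauss d M k

module _ {N : ℕ} (d : ℕ) where
  open SetoidReasoning (Ring.setoid {N})
  open import Algebra.Solver.Ring.NaturalCoefficients.Default (truncated N)

  gauss-beyond : ∀ M k → M < k → gauss d M k ≈[ N ] zeroPS
  gauss-beyond zero    (suc k) _         = Ring.refl
  gauss-beyond (suc M) (suc k) (s≤s M<k) = begin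
    gauss d M (suc k) ⊕ mono 1ℤ (d ℕ.* (M ∸ k)) ⊗ gauss d M k
      ≈⟨ Ring.+-cong (gauss-beyond M (suc k) (ℕₚ.m<n⇒m<1+n M<k))
                     (Ring.*-cong Ring.refl (gauss-beyond M k M<k)) ⟩
    zeroPS ⊕ mono 1ℤ (d ℕ.* (M ∸ k)) ⊗ zeroPS
      ≈⟨ Ring.trans (Ring.+-identityˡ _) (Ring.zeroʳ _) ⟩
    zeroPS ∎

  gauss-diagonal : ∀ M → gauss d M M ≈[ N ] onePS
  gauss-diagonal zero    = Ring.refl
  gauss-diagonal (suc M) = begin
    gauss d M (suc M) ⊕ mono 1ℤ (d ℕ.* (M ∸ M)) ⊗ gauss d M M
      ≈⟨ Ring.+-cong (gauss-beyond M (suc M) ℕₚ.≤-refl)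
                     (Ring.*-cong (Ring.reflexive (cong (mono 1ℤ) zero-exponent)) (gauss-diagonal M)) ⟩
    zeroPS ⊕ mono 1ℤ 0 ⊗ onePS
      ≈⟨ Ring.trans (Ring.+-identityˡ _) (Ring.trans (Ring.*-identityʳ _) (exact mono-1)) ⟩
    onePS ∎
    where
    zero-exponent : d ℕ.* (M ∸ M) ≡ 0
    zero-exponent = trans (cong (d ℕ.*_) (ℕₚ.n∸n≡0 M)) (ℕₚ.*-zeroʳ d)

  private
    w : ℕ → PS
    w i = factor -1ℤ (d ℕ.+ d ℕ.* i)

  -- The terms ±q^(d(B+1)) cancel. This is the q-analogue of (B+1) + (A+1) = A+B+2, on which
  -- Pascal's rule for quotients of factorials depends.
  w-pascal : ∀ A B → w B ⊕ mono 1ℤ (d ℕ.* suc B) ⊗ w A ≈[ N ] w (suc (A ℕ.+ B))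
  w-pascal A B = begin
    w B ⊕ mono 1ℤ (d ℕ.* suc B) ⊗ w A
      ≈⟨ solve 3 (λ x y z → con 1 :+ x :+ y :* (con 1 :+ z) := con 1 :+ (y :+ x) :+ y :* z) Ring.refl
           (mono -1ℤ (d ℕ.+ d ℕ.* B)) (mono 1ℤ (d ℕ.* suc B)) (mono -1ℤ (d ℕ.+ d ℕ.* A)) ⟩
    onePS ⊕ (mono 1ℤ (d ℕ.* suc B) ⊕ mono -1ℤ (d ℕ.+ d ℕ.* B)) ⊕ mono 1ℤ (d ℕ.* suc B) ⊗ mono -1ℤ (d ℕ.+ d ℕ.* A)
      ≈⟨ Ring.+-cong
           (Ring.+-cong Ring.refl (Ring.trans
             (Ring.+-cong (Ring.reflexive (cong (mono 1ℤ) (ℕₚ.*-suc d B))) Ring.refl)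
             (mono-cancel (d ℕ.+ d ℕ.* B))))
           (Ring.trans (mono-* 1ℤ (d ℕ.* suc B) -1ℤ (d ℕ.+ d ℕ.* A)) (Ring.reflexive (cong (mono -1ℤ) (exponents d A B)))) ⟩
    onePS ⊕ zeroPS ⊕ mono -1ℤ (d ℕ.+ d ℕ.* suc (A ℕ.+ B))
      ≈⟨ Ring.+-cong (Ring.+-identityʳ onePS) Ring.refl ⟩
    w (suc (A ℕ.+ B)) ∎
    where
    exponents : ∀ d A B → d ℕ.* suc B ℕ.+ (d ℕ.+ d ℕ.* A) ≡ d ℕ.+ d ℕ.* suc (A ℕ.+ B)
    exponents = ℕ-Solver.solve-∀

  -- The quotient formula for the q-binomial, cleared of denominators. Pascal's rule leads to the
  -- pairs `(suc A , B)` and `(A , suc B)`, and `w-pascal` adds the two contributions.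
  gauss-factorial : ∀ A B → gauss d (A ℕ.+ B) A ⊗ (pochTo -1ℤ d d A ⊗ pochTo -1ℤ d d B)
                    ≈[ N ] pochTo -1ℤ d d (A ℕ.+ B)
  gauss-factorial zero B = Ring.trans (Ring.*-identityˡ _) (Ring.*-identityˡ _)
  gauss-factorial (suc A) zero rewrite ℕₚ.+-identityʳ A =
    Ring.trans (Ring.*-cong (gauss-diagonal (suc A)) (Ring.*-identityʳ _)) (Ring.*-identityˡ _)
  gauss-factorial (suc A) (suc B) rewrite ℕₚ.+-suc A B = begin
    (G₁ ⊕ mono 1ℤ (d ℕ.* (suc (A ℕ.+ B) ∸ A)) ⊗ G₂) ⊗ (P A ⊗ w A ⊗ (P B ⊗ w B))
      ≈⟨ Ring.*-cong (Ring.+-cong Ring.refl (Ring.*-cong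
           (Ring.reflexive (cong (λ n → mono 1ℤ (d ℕ.* n)) gap)) Ring.refl)) Ring.refl ⟩
    (G₁ ⊕ Q ⊗ G₂) ⊗ (P A ⊗ w A ⊗ (P B ⊗ w B))
      ≈⟨ solve 7 (λ g₁ g₂ q a wa b wb →
             (g₁ :+ q :* g₂) :* (a :* wa :* (b :* wb)) :=
             g₁ :* (a :* wa :* b) :* wb :+ q :* wa :* (g₂ :* (a :* (b :* wb))))
           Ring.refl G₁ G₂ Q (P A) (w A) (P B) (w B) ⟩
    G₁ ⊗ (P (suc A) ⊗ P B) ⊗ w B ⊕ Q ⊗ w A ⊗ (G₂ ⊗ (P A ⊗ P (suc B)))
      ≈⟨ Ring.+-cong (Ring.*-cong (gauss-factorial (suc A) B) Ring.refl)
                     (Ring.*-cong Ring.refl ih₂) ⟩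
    P (suc (A ℕ.+ B)) ⊗ w B ⊕ Q ⊗ w A ⊗ P (suc (A ℕ.+ B))
      ≈⟨ solve 4 (λ p b q a → p :* b :+ q :* a :* p := p :* (b :+ q :* a)) Ring.refl
           (P (suc (A ℕ.+ B))) (w B) Q (w A) ⟩
    P (suc (A ℕ.+ B)) ⊗ (w B ⊕ Q ⊗ w A)
      ≈⟨ Ring.*-cong Ring.refl (w-pascal A B) ⟩
    P (suc (suc (A ℕ.+ B))) ∎
    where
    P : ℕ → PS
    P = pochTo -1ℤ d d
    Q G₁ G₂ : PS
    Q  = mono 1ℤ (d ℕ.* suc B)
    G₁ = gauss d (suc (A ℕ.+ B)) (suc A)
    G₂ = gauss d (suc (A ℕ.+ B)) A
    gap : suc (A ℕ.+ B) ∸ A ≡ suc B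
    gap = trans (cong (_∸ A) (sym (ℕₚ.+-suc A B))) (ℕₚ.m+n∸m≡n A (suc B))
    ih₂ : G₂ ⊗ (P A ⊗ P (suc B)) ≈[ N ] P (suc (A ℕ.+ B))
    ih₂ = subst (λ M → gauss d M A ⊗ (P A ⊗ P (suc B)) ≈[ N ] P M)
            (ℕₚ.+-suc A B) (gauss-factorial A (suc B))

  -- One step of Rothe's identity ∏_{i<M} (1 + x_i) = Σ_k [M choose k] t_k.
  rothe-step : ∀ (t : ℕ → PS) x M →
    (∀ k → k ≤ M → t k ⊗ x ≈[ N ] mono 1ℤ (d ℕ.* (M ∸ k)) ⊗ t (suc k)) →
    ∑ (λ k → gauss d (suc M) k ⊗ t k) (suc (suc M)) ≈[ N ]
    ∑ (λ k → gauss d M k ⊗ t k) (suc M) ⊗ (onePS ⊕ x)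
  rothe-step t x M step = begin
    ∑ (λ k → gauss d (suc M) k ⊗ t k) (suc (suc M))
      ≈⟨ ∑-front _ (suc M) ⟩
    onePS ⊗ t 0 ⊕ ∑ (λ k → (gauss d M (suc k) ⊕ Q k ⊗ gauss d M k) ⊗ t (suc k)) (suc M)
      ≈⟨ Ring.+-cong Ring.refl (Ring.trans (∑-cong (suc M) λ k k≤M → expand k (ℕₚ.≤-pred k≤M))
           (∑-⊕ _ _ (suc M))) ⟩
    onePS ⊗ t 0 ⊕ (∑ (λ k → gauss d M (suc k) ⊗ t (suc k)) (suc M)
                   ⊕ ∑ (λ k → gauss d M k ⊗ t k ⊗ x) (suc M))
      ≈⟨ Ring.+-assoc _ _ _ ⟨
    onePS ⊗ t 0 ⊕ ∑ (λ k → gauss d M (suc k) ⊗ t (suc k)) (suc M)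
      ⊕ ∑ (λ k → gauss d M k ⊗ t k ⊗ x) (suc M)
      ≈⟨ Ring.+-cong (Ring.sym (∑-front (λ k → gauss d M k ⊗ t k) (suc M))) (∑-⊗ _ x (suc M)) ⟩
    S ⊕ gauss d M (suc M) ⊗ t (suc M) ⊕ S ⊗ x
      ≈⟨ Ring.+-cong (Ring.+-cong Ring.refl (Ring.trans
           (Ring.*-cong (gauss-beyond M (suc M) ℕₚ.≤-refl) Ring.refl) (Ring.zeroˡ _))) Ring.refl ⟩
    S ⊕ zeroPS ⊕ S ⊗ x
      ≈⟨ solve 2 (λ s x → s :+ con 0 :+ s :* x := s :* (con 1 :+ x)) Ring.refl S x ⟩
    S ⊗ (onePS ⊕ x) ∎
    where
    S : PS
    S = ∑ (λ k → gauss d M k ⊗ t k) (suc M)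
    Q : ℕ → PS
    Q k = mono 1ℤ (d ℕ.* (M ∸ k))
    expand : ∀ k → k ≤ M → (gauss d M (suc k) ⊕ Q k ⊗ gauss d M k) ⊗ t (suc k) ≈[ N ]
             gauss d M (suc k) ⊗ t (suc k) ⊕ gauss d M k ⊗ t k ⊗ x
    expand k k≤M = begin
      (gauss d M (suc k) ⊕ Q k ⊗ gauss d M k) ⊗ t (suc k)
        ≈⟨ solve 4 (λ a q g t → (a :+ q :* g) :* t := a :* t :+ g :* (q :* t)) Ring.refl
             (gauss d M (suc k)) (Q k) (gauss d M k) (t (suc k)) ⟩
      gauss d M (suc k) ⊗ t (suc k) ⊕ gauss d M k ⊗ (Q k ⊗ t (suc k))
        ≈⟨ Ring.+-cong Ring.refl (Ring.trans (Ring.*-cong Ring.refl (Ring.sym (step k k≤M)))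
             (Ring.sym (Ring.*-assoc _ _ _))) ⟩
      gauss d M (suc k) ⊗ t (suc k) ⊕ gauss d M k ⊗ t k ⊗ x ∎

module _ (d′ : ℕ) where
  private
    d : ℕ
    d = suc d′
    P : ℕ → PS
    P = pochTo -1ℤ d d

  -- Modulo q^j all factorials of length at least j agree, so the factorial formula reads G P P = P
  -- and one P cancels: the binomial tends to 1/(q^d; q^d)_∞.
  gauss-limit : ∀ {j} A B K → j ≤ A → j ≤ B → j ≤ K →
                gauss d (A ℕ.+ B) A ⊗ P K ≈[ j ] onePS
  gauss-limit {j} A B K j≤A j≤B j≤K = pochTo-cancel d′ d′ K (begin
    gauss d (A ℕ.+ B) A ⊗ P K ⊗ P K
      ≈⟨ Ring.*-assoc _ _ _ ⟩
    gauss d (A ℕ.+ B) A ⊗ (P K ⊗ P K)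
      ≈⟨ Ring.*-cong Ring.refl (Ring.*-cong (stable j≤K j≤A) (stable j≤K j≤B)) ⟩
    gauss d (A ℕ.+ B) A ⊗ (P A ⊗ P B)
      ≈⟨ gauss-factorial d A B ⟩
    P (A ℕ.+ B)
      ≈⟨ stable (ℕₚ.≤-trans j≤A (ℕₚ.m≤m+n A B)) j≤K ⟩
    P K
      ≈⟨ Ring.*-identityˡ _ ⟨
    onePS ⊗ P K ∎)
    where
    open ≈-Reasoning {j}
    stable : ∀ {m n} → j ≤ m → j ≤ n → P m ≈[ j ] P n
    stable = pochTo-stable -1ℤ d′ d′

  -- Both sides have the same product with the (invertible) factorials.
  gauss-symmetric : ∀ {N} A B → gauss d (A ℕ.+ B) A ≈[ N ] gauss d (A ℕ.+ B) B
  gauss-symmetric {N} A B = pochTo-cancel d′ d′ A (pochTo-cancel d′ d′ B (begin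
    gauss d (A ℕ.+ B) A ⊗ P A ⊗ P B
      ≈⟨ Ring.*-assoc _ _ _ ⟩
    gauss d (A ℕ.+ B) A ⊗ (P A ⊗ P B)
      ≈⟨ gauss-factorial d A B ⟩
    P (A ℕ.+ B)
      ≡⟨ cong P (ℕₚ.+-comm A B) ⟩
    P (B ℕ.+ A)
      ≈⟨ gauss-factorial d B A ⟨
    gauss d (B ℕ.+ A) B ⊗ (P B ⊗ P A)
      ≡⟨ cong (λ M → gauss d M B ⊗ (P B ⊗ P A)) (ℕₚ.+-comm B A) ⟩
    gauss d (A ℕ.+ B) B ⊗ (P B ⊗ P A)
      ≈⟨ Ring.trans (Ring.*-cong Ring.refl (Ring.*-comm _ _)) (Ring.sym (Ring.*-assoc _ _ _)) ⟩
    gauss d (A ℕ.+ B) B ⊗ P A ⊗ P B ∎))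
    where
    open ≈-Reasoning {N}

-- Theta series

tri : ℕ → ℕ
tri zero    = 0
tri (suc n) = suc n ℕ.+ tri n

-- p m(m+1)/2 + r m(m-1)/2
quad : ℕ → ℕ → ℤ → ℕ
quad p r (+ n)    = p ℕ.* tri n ℕ.+ r ℕ.* tri (pred n)
quad p r -[1+ n ] = p ℕ.* tri n ℕ.+ r ℕ.* tri (suc n)

-- The increments are the exponents of the factors of `pochTo c p (p + r)`, and those in `quad-down`
-- belong to `pochTo c r (p + r)`. This is what ties a theta series to its product.
quad-up : ∀ p r j → quad p r (+ suc j) ≡ quad p r (+ j) ℕ.+ (p ℕ.+ (p ℕ.+ r) ℕ.* j)
quad-up p r zero    = base p r
  where
  base : ∀ p r → p ℕ.* 1 ℕ.+ r ℕ.* 0 ≡ p ℕ.* 0 ℕ.+ r ℕ.* 0 ℕ.+ (p ℕ.+ (p ℕ.+ r) ℕ.* 0)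
  base = ℕ-Solver.solve-∀
quad-up p r (suc j) = step p r j (tri j)
  where
  step : ∀ p r j t → p ℕ.* (suc (suc j) ℕ.+ (suc j ℕ.+ t)) ℕ.+ r ℕ.* (suc j ℕ.+ t) ≡
         p ℕ.* (suc j ℕ.+ t) ℕ.+ r ℕ.* t ℕ.+ (p ℕ.+ (p ℕ.+ r) ℕ.* suc j)
  step = ℕ-Solver.solve-∀

quad-neg : ∀ p r m → quad p r (- m) ≡ quad r p m
quad-neg p r (+ zero)  = ℕₚ.+-comm (p ℕ.* 0) (r ℕ.* 0)
quad-neg p r (+ suc n) = ℕₚ.+-comm (p ℕ.* tri n) _
quad-neg p r -[1+ n ]  = ℕₚ.+-comm (p ℕ.* tri (suc n)) _

quad-down : ∀ p r j → quad p r -[1+ j ] ≡ quad p r (- + j) ℕ.+ (r ℕ.+ (p ℕ.+ r) ℕ.* j)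
quad-down p r j = trans (quad-neg p r (+ suc j)) (trans (quad-up r p j)
  (cong₂ ℕ._+_ (sym (quad-neg p r (+ j))) (cong (λ d → r ℕ.+ d ℕ.* j) (ℕₚ.+-comm r p))))

n≤tri : ∀ n → n ≤ tri n
n≤tri zero    = z≤n
n≤tri (suc n) = ℕₚ.m≤m+n (suc n) (tri n)

abs≤quad : ∀ p r m → ∣ m ∣ ≤ quad (suc p) (suc r) m
abs≤quad p r (+ n)    = ℕₚ.≤-trans (n≤tri n)
  (ℕₚ.≤-trans (ℕₚ.m≤m+n (tri n) (p ℕ.* tri n)) (ℕₚ.m≤m+n _ _))
abs≤quad p r -[1+ n ] = ℕₚ.≤-trans (n≤tri (suc n))
  (ℕₚ.≤-trans (ℕₚ.m≤m+n (tri (suc n)) (r ℕ.* tri (suc n))) (ℕₚ.m≤n+m _ _))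

thetaTerm : ℤ → ℕ → ℕ → ℤ → PS
thetaTerm c p r m = mono (c ℤ.^ ∣ m ∣) (quad p r m)

-- Σ_{|m| ≤ K} c^m q^{quad p r m}; only used with c = ±1, where c^m = c^|m|.
theta : ℤ → ℕ → ℕ → ℕ → PS
theta c p r K = ∑ (λ k → thetaTerm c p r (k ⊖ K)) (suc (K ℕ.+ K))

[m+n]⊖m : ∀ m n → (m ℕ.+ n) ⊖ m ≡ + n
[m+n]⊖m m n = trans (ℤₚ.⊖-≥ (ℕₚ.m≤m+n m n)) (cong +_ (ℕₚ.m+n∸m≡n m n))

m⊖[m+n] : ∀ m n → m ⊖ (m ℕ.+ n) ≡ - + n
m⊖[m+n] m n = trans (ℤₚ.⊖-≤ (ℕₚ.m≤m+n m n)) (cong (-_ ∘ +_) (ℕₚ.m+n∸m≡n m n))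

reflected-gap : ∀ k N → N ≤ k → k ≤ N ℕ.+ N → N ≤ ∣ k ⊖ N ∣ ℕ.+ (N ℕ.+ N ∸ k)
reflected-gap k N N≤k k≤2N = ℕₚ.+-cancelˡ-≤ N _ _ (ℕₚ.≤-reflexive (begin
  N ℕ.+ N                                ≡⟨ ℕₚ.m+[n∸m]≡n k≤2N ⟨
  k ℕ.+ (N ℕ.+ N ∸ k)                    ≡⟨ cong (ℕ._+ (N ℕ.+ N ∸ k)) (ℕₚ.m+[n∸m]≡n N≤k) ⟨
  N ℕ.+ (k ∸ N) ℕ.+ (N ℕ.+ N ∸ k)        ≡⟨ ℕₚ.+-assoc N _ _ ⟩
  N ℕ.+ (k ∸ N ℕ.+ (N ℕ.+ N ∸ k))        ≡⟨ cong (λ m → N ℕ.+ (∣ m ∣ ℕ.+ (N ℕ.+ N ∸ k))) (ℤₚ.⊖-≥ N≤k) ⟨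
  N ℕ.+ (∣ k ⊖ N ∣ ℕ.+ (N ℕ.+ N ∸ k))    ∎))
  where open ≡-Reasoning

-- The Jacobi triple product

module TripleProduct (c : ℤ) (c*c≡1 : c ℤ.* c ≡ 1ℤ) (p′ r′ : ℕ) where
  private
    p r d : ℕ
    p = suc p′
    r = suc r′
    d = p ℕ.+ r
    T : ℤ → PS
    T = thetaTerm c p r

  -- Rothe's identity for the factors 1 + c q^(r + d i). Its k-th monomial has exponent r k + d
  -- k(k-1)/2, which is `quad p r (- + k)`.
  one-sided : ∀ {N} B → ∑ (λ k → gauss d B k ⊗ T (- + k)) (suc B) ≈[ N ] pochTo c r d B
  one-sided zero    = Ring.trans (Ring.+-identityˡ _) (Ring.trans (Ring.*-identityˡ _)
    (Ring.trans (Ring.reflexive (cong (mono 1ℤ) (quad-zero p r))) (exact mono-1)))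
    where
    quad-zero : ∀ p r → p ℕ.* 0 ℕ.+ r ℕ.* 0 ≡ 0
    quad-zero = ℕ-Solver.solve-∀
  one-sided {N} (suc B) = Ring.trans
    (rothe-step d (λ k → T (- + k)) (mono c (r ℕ.+ d ℕ.* B)) B step)
    (Ring.*-cong (one-sided B) Ring.refl)
    where
    step : ∀ k → k ≤ B →
      T (- + k) ⊗ mono c (r ℕ.+ d ℕ.* B) ≈[ N ] mono 1ℤ (d ℕ.* (B ∸ k)) ⊗ T (- + suc k)
    step k k≤B with ℕₚ.m≤n⇒∃[o]m+o≡n k≤B
    ... | l , refl rewrite ℕₚ.m+n∸m≡n k l = begin
      T (- + k) ⊗ mono c (r ℕ.+ d ℕ.* (k ℕ.+ l))
        ≈⟨ mono-* (c ℤ.^ ∣ - + k ∣) (quad p r (- + k)) c (r ℕ.+ d ℕ.* (k ℕ.+ l)) ⟩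
      mono (c ℤ.^ ∣ - + k ∣ ℤ.* c) (quad p r (- + k) ℕ.+ (r ℕ.+ d ℕ.* (k ℕ.+ l)))
        ≡⟨ cong₂ mono
             (trans (cong (λ n → c ℤ.^ n ℤ.* c) (ℤₚ.∣-i∣≡∣i∣ (+ k)))
               (trans (ℤₚ.*-comm _ c) (sym (ℤₚ.*-identityˡ _))))
             (trans (shuffle (quad p r (- + k)) r d k l)
               (cong (d ℕ.* l ℕ.+_) (sym (quad-down p r k)))) ⟩
      mono (1ℤ ℤ.* c ℤ.^ suc k) (d ℕ.* l ℕ.+ quad p r (- + suc k))
        ≈⟨ mono-* 1ℤ (d ℕ.* l) (c ℤ.^ suc k) (quad p r (- + suc k)) ⟨
      mono 1ℤ (d ℕ.* l) ⊗ T (- + suc k) ∎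
      where
      open ≈-Reasoning {N}
      shuffle : ∀ e r d k l → e ℕ.+ (r ℕ.+ d ℕ.* (k ℕ.+ l)) ≡ d ℕ.* l ℕ.+ (e ℕ.+ (r ℕ.+ d ℕ.* k))
      shuffle = ℕ-Solver.solve-∀

  -- Reversal together with the symmetry of the binomials gives the indexing by `k ⊖ B`, the base
  -- case A = 0 of the two-sided product.
  one-sided-reversed : ∀ {N} B →
    ∑ (λ k → gauss d B k ⊗ T (k ⊖ B)) (suc B) ≈[ N ] pochTo c r d B
  one-sided-reversed {N} B = Ring.trans (Ring.sym (Ring.trans
    (∑-reverse (λ k → gauss d B k ⊗ T (- + k)) B)
    (∑-cong (suc B) λ k k<B → reflect k (ℕₚ.≤-pred k<B)))) (one-sided B)
    where
    reflect : ∀ k → k ≤ B →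
      gauss d B (B ∸ k) ⊗ T (- + (B ∸ k)) ≈[ N ] gauss d B k ⊗ T (k ⊖ B)
    reflect k k≤B with ℕₚ.m≤n⇒∃[o]m+o≡n k≤B
    ... | l , refl rewrite ℕₚ.m+n∸m≡n k l | m⊖[m+n] k l =
      Ring.*-cong (Ring.sym (gauss-symmetric (p′ ℕ.+ r) k l)) Ring.refl

  -- The hypothesis of `rothe-step` for appending the factor with exponent p + d A. The two sides of
  -- the centre k = B are treated separately, since `∣ k ⊖ B ∣` falls on one and rises on the other.
  theta-step : ∀ {N} A B k → k ≤ A ℕ.+ B →
    T (k ⊖ B) ⊗ mono c (p ℕ.+ d ℕ.* A) ≈[ N ] mono 1ℤ (d ℕ.* (A ℕ.+ B ∸ k)) ⊗ T (suc k ⊖ B)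
  theta-step {N} A B k k≤A+B = begin
    T (k ⊖ B) ⊗ mono c (p ℕ.+ d ℕ.* A)
      ≈⟨ mono-* (c ℤ.^ ∣ k ⊖ B ∣) (quad p r (k ⊖ B)) c (p ℕ.+ d ℕ.* A) ⟩
    mono (c ℤ.^ ∣ k ⊖ B ∣ ℤ.* c) (quad p r (k ⊖ B) ℕ.+ (p ℕ.+ d ℕ.* A))
      ≡⟨ cong₂ mono (trans (signs (ℕₚ.<-≤-connex k B)) (sym (ℤₚ.*-identityˡ _)))
           (exponents (ℕₚ.<-≤-connex k B)) ⟩
    mono (1ℤ ℤ.* c ℤ.^ ∣ suc k ⊖ B ∣) (d ℕ.* (A ℕ.+ B ∸ k) ℕ.+ quad p r (suc k ⊖ B))
      ≈⟨ mono-* 1ℤ (d ℕ.* (A ℕ.+ B ∸ k)) (c ℤ.^ ∣ suc k ⊖ B ∣) (quad p r (suc k ⊖ B)) ⟨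
    mono 1ℤ (d ℕ.* (A ℕ.+ B ∸ k)) ⊗ T (suc k ⊖ B) ∎
    where
    open ≈-Reasoning {N}
    k⊖ : ∀ k j → k ⊖ (suc k ℕ.+ j) ≡ -[1+ j ]
    k⊖ k j = trans (cong (k ⊖_) (sym (ℕₚ.+-suc k j))) (m⊖[m+n] k (suc j))

    suc⊖ : ∀ B j → suc (B ℕ.+ j) ⊖ B ≡ + suc j
    suc⊖ B j = trans (cong (_⊖ B) (sym (ℕₚ.+-suc B j))) ([m+n]⊖m B (suc j))

    -- Left of the centre the absolute value drops by one, and the surplus c² is absorbed by
    -- `c*c≡1`.
    signs : k < B ⊎ B ≤ k → c ℤ.^ ∣ k ⊖ B ∣ ℤ.* c ≡ c ℤ.^ ∣ suc k ⊖ B ∣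
    signs (inj₁ k<B) with ℕₚ.m≤n⇒∃[o]m+o≡n k<B
    ... | j , refl rewrite k⊖ k j | m⊖[m+n] (suc k) j | ℤₚ.∣-i∣≡∣i∣ (+ j) =
      trans (regroup c (c ℤ.^ j)) (trans (cong (ℤ._* c ℤ.^ j) c*c≡1) (ℤₚ.*-identityˡ _))
      where
      regroup : ∀ c x → c ℤ.* x ℤ.* c ≡ c ℤ.* c ℤ.* x
      regroup = solve-∀
    signs (inj₂ B≤k) with ℕₚ.m≤n⇒∃[o]m+o≡n B≤k
    ... | j , refl rewrite suc⊖ B j | [m+n]⊖m B j = ℤₚ.*-comm (c ℤ.^ j) c

    gap< : ∀ A k j → A ℕ.+ (suc k ℕ.+ j) ∸ k ≡ A ℕ.+ suc j
    gap< A k j = trans (cong (_∸ k) (rearrange A k j)) (ℕₚ.m+n∸m≡n k (A ℕ.+ suc j))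
      where
      rearrange : ∀ A k j → A ℕ.+ (suc k ℕ.+ j) ≡ k ℕ.+ (A ℕ.+ suc j)
      rearrange = ℕ-Solver.solve-∀

    gap≥ : ∀ B j l → j ℕ.+ l ℕ.+ B ∸ (B ℕ.+ j) ≡ l
    gap≥ B j l = trans (cong (_∸ (B ℕ.+ j)) (rearrange B j l)) (ℕₚ.m+n∸m≡n (B ℕ.+ j) l)
      where
      rearrange : ∀ B j l → j ℕ.+ l ℕ.+ B ≡ B ℕ.+ j ℕ.+ l
      rearrange = ℕ-Solver.solve-∀

    exponents : k < B ⊎ B ≤ k →
      quad p r (k ⊖ B) ℕ.+ (p ℕ.+ d ℕ.* A) ≡ d ℕ.* (A ℕ.+ B ∸ k) ℕ.+ quad p r (suc k ⊖ B)
    exponents (inj₁ k<B) with ℕₚ.m≤n⇒∃[o]m+o≡n k<B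
    ... | j , refl rewrite k⊖ k j | m⊖[m+n] (suc k) j | gap< A k j | quad-down p r j =
      shuffle (quad p r (- + j)) p r A j
      where
      shuffle : ∀ e p r A j → e ℕ.+ (r ℕ.+ (p ℕ.+ r) ℕ.* j) ℕ.+ (p ℕ.+ (p ℕ.+ r) ℕ.* A) ≡
                (p ℕ.+ r) ℕ.* (A ℕ.+ suc j) ℕ.+ e
      shuffle = ℕ-Solver.solve-∀
    exponents (inj₂ B≤k) with ℕₚ.m≤n⇒∃[o]m+o≡n B≤k
    ... | j , refl with ℕₚ.m≤n⇒∃[o]m+o≡n (ℕₚ.+-cancelˡ-≤ B j A (subst (B ℕ.+ j ≤_) (ℕₚ.+-comm A B) k≤A+B))
    ... | l , refl rewrite suc⊖ B j | [m+n]⊖m B j | gap≥ B j l | quad-up p r j =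
      shuffle (quad p r (+ j)) p r j l
      where
      shuffle : ∀ e p r j l → e ℕ.+ (p ℕ.+ (p ℕ.+ r) ℕ.* (j ℕ.+ l)) ≡
                (p ℕ.+ r) ℕ.* l ℕ.+ (e ℕ.+ (p ℕ.+ (p ℕ.+ r) ℕ.* j))
      shuffle = ℕ-Solver.solve-∀

  -- Induction on A with B fixed keeps the centre of the sum at index B, so the terms `T (k ⊖ B)` do
  -- not change from step to step.
  finite-triple-product : ∀ {N} A B →
    ∑ (λ k → gauss d (A ℕ.+ B) k ⊗ T (k ⊖ B)) (suc (A ℕ.+ B)) ≈[ N ]
    pochTo c r d B ⊗ pochTo c p d A
  finite-triple-product zero    B = Ring.trans (one-sided-reversed B) (Ring.sym (Ring.*-identityʳ _))
  finite-triple-product (suc A) B = Ring.trans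
    (rothe-step d (λ k → T (k ⊖ B)) (mono c (p ℕ.+ d ℕ.* A)) (A ℕ.+ B) (theta-step A B))
    (Ring.trans (Ring.*-cong (finite-triple-product A B) Ring.refl) (Ring.*-assoc _ _ _))

  jacobi-triple-product : ∀ {N} →
    pochTo c r d N ⊗ pochTo c p d N ⊗ pochTo -1ℤ d d N ≈[ N ] theta c p r N
  jacobi-triple-product {N} = begin
    pochTo c r d N ⊗ pochTo c p d N ⊗ P
      ≈⟨ Ring.*-cong (finite-triple-product N N) Ring.refl ⟨
    ∑ (λ k → gauss d (N ℕ.+ N) k ⊗ T (k ⊖ N)) (suc (N ℕ.+ N)) ⊗ P
      ≈⟨ ∑-⊗ _ P (suc (N ℕ.+ N)) ⟨
    ∑ (λ k → gauss d (N ℕ.+ N) k ⊗ T (k ⊖ N) ⊗ P) (suc (N ℕ.+ N))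
      ≈⟨ ∑-cong (suc (N ℕ.+ N)) (λ k k≤2N → limit k (ℕₚ.≤-pred k≤2N)) ⟩
    theta c p r N ∎
    where
    open ≈-Reasoning {N}
    open import Algebra.Solver.Ring.NaturalCoefficients.Default (truncated N)
    P : PS
    P = pochTo -1ℤ d d N

    -- [2N choose k] (q^d;q^d)_∞ is 1 up to order min(k, 2N-k), and the theta
    -- term contributes the missing |k - N|.
    raise : ∀ {j} k l → k ℕ.+ l ≡ N ℕ.+ N → j ≤ k → j ≤ l → j ≤ N → N ≤ ∣ k ⊖ N ∣ ℕ.+ j →
            gauss d (N ℕ.+ N) k ⊗ T (k ⊖ N) ⊗ P ≈[ N ] T (k ⊖ N)
    raise {j} k l k+l≡2N j≤k j≤l j≤N N≤ = begin
      gauss d (N ℕ.+ N) k ⊗ T (k ⊖ N) ⊗ P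
        ≈⟨ solve 3 (λ g t p → g :* t :* p := t :* (g :* p)) Ring.refl (gauss d (N ℕ.+ N) k) (T (k ⊖ N)) P ⟩
      T (k ⊖ N) ⊗ (gauss d (N ℕ.+ N) k ⊗ P)
        ≈⟨ mono-raise (c ℤ.^ ∣ k ⊖ N ∣) (quad p r (k ⊖ N))
             (ℕₚ.≤-trans N≤ (ℕₚ.+-monoˡ-≤ j (abs≤quad p′ r′ (k ⊖ N))))
             (subst (λ M → gauss d M k ⊗ P ≈[ j ] onePS) k+l≡2N
               (gauss-limit (p′ ℕ.+ r) k l N j≤k j≤l j≤N)) ⟩
      T (k ⊖ N) ⊗ onePS
        ≈⟨ Ring.*-identityʳ _ ⟩
      T (k ⊖ N) ∎

    limit : ∀ k → k ≤ N ℕ.+ N → gauss d (N ℕ.+ N) k ⊗ T (k ⊖ N) ⊗ P ≈[ N ] T (k ⊖ N)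
    limit k k≤2N with ℕₚ.≤-total k N
    ... | inj₁ k≤N = raise k (N ℕ.+ N ∸ k) (ℕₚ.m+[n∸m]≡n k≤2N) ℕₚ.≤-refl
      (subst (k ≤_) (sym (ℕₚ.+-∸-assoc N k≤N)) (ℕₚ.≤-trans k≤N (ℕₚ.m≤m+n N (N ∸ k)))) k≤N
      (ℕₚ.≤-reflexive (sym (trans (cong (ℕ._+ k) (ℤₚ.∣⊖∣-≤ k≤N)) (ℕₚ.m∸n+n≡m k≤N))))
    ... | inj₂ N≤k = raise k (N ℕ.+ N ∸ k) (ℕₚ.m+[n∸m]≡n k≤2N)
      (ℕₚ.≤-trans l≤N N≤k) ℕₚ.≤-refl l≤N
      (reflected-gap k N N≤k k≤2N)
      where
      l≤N : N ℕ.+ N ∸ k ≤ N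
      l≤N = ℕₚ.m≤n+o⇒m∸n≤o (N ℕ.+ N) k (ℕₚ.+-monoˡ-≤ N N≤k)

-- Sums over lists

private variable
  A B : Set

sumL : (A → ℤ) → List A → ℤ
sumL f []       = 0ℤ
sumL f (x ∷ xs) = f x ℤ.+ sumL f xs

sumL-cong : ∀ {f g : A → ℤ} → (∀ x → f x ≡ g x) → ∀ xs → sumL f xs ≡ sumL g xs
sumL-cong eq []       = refl
sumL-cong eq (x ∷ xs) = cong₂ ℤ._+_ (eq x) (sumL-cong eq xs)

sumL-++ : ∀ (f : A → ℤ) xs ys → sumL f (xs ++ ys) ≡ sumL f xs ℤ.+ sumL f ys
sumL-++ f []       ys = sym (ℤₚ.+-identityˡ _)
sumL-++ f (x ∷ xs) ys = trans (cong (λ s → f x ℤ.+ s) (sumL-++ f xs ys)) (sym (ℤₚ.+-assoc (f x) _ _))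

sumL-map : ∀ (f : A → ℤ) (g : B → A) xs → sumL f (map g xs) ≡ sumL (f ∘ g) xs
sumL-map f g []       = refl
sumL-map f g (x ∷ xs) = cong (λ s → f (g x) ℤ.+ s) (sumL-map f g xs)

sumL-neg : ∀ (f : A → ℤ) xs → sumL (-_ ∘ f) xs ≡ - sumL f xs
sumL-neg f []       = refl
sumL-neg f (x ∷ xs) = trans (cong (λ s → - f x ℤ.+ s) (sumL-neg f xs)) (sym (ℤₚ.neg-distrib-+ (f x) _))

sumL-↭ : ∀ (f : A → ℤ) {xs ys} → xs ↭ ys → sumL f xs ≡ sumL f ys
sumL-↭ f Perm.refl        = refl
sumL-↭ f (Perm.prep x p)   = cong (λ s → f x ℤ.+ s) (sumL-↭ f p)
sumL-↭ f (Perm.swap x y p) =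
  trans (cong (λ s → f x ℤ.+ (f y ℤ.+ s)) (sumL-↭ f p)) (exchange (f x) (f y) _)
  where
  exchange : ∀ a b c → a ℤ.+ (b ℤ.+ c) ≡ b ℤ.+ (a ℤ.+ c)
  exchange = solve-∀
sumL-↭ f (Perm.trans p q) = trans (sumL-↭ f p) (sumL-↭ f q)

sumTo-sumL : ∀ f n → sumTo f n ≡ sumL f (upTo n)
sumTo-sumL f zero    = refl
sumTo-sumL f (suc n) = begin
  sumTo f n ℤ.+ f n                     ≡⟨ cong₂ ℤ._+_ (sumTo-sumL f n) (sym (ℤₚ.+-identityʳ (f n))) ⟩
  sumL f (upTo n) ℤ.+ sumL f (n ∷ [])   ≡⟨ sumL-++ f (upTo n) (n ∷ []) ⟨
  sumL f (upTo n ++ n ∷ [])             ≡⟨ cong (sumL f) (upTo-∷ʳ n) ⟩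
  sumL f (upTo (suc n))                 ∎
  where open ≡-Reasoning

module _ (f : A → ℤ) where
  private
    nonzero? : Decidable (λ x → f x ≢ 0ℤ)
    nonzero? x = ¬? (f x ℤ.≟ 0ℤ)

  sumL-filter : ∀ xs → sumL f (filter nonzero? xs) ≡ sumL f xs
  sumL-filter [] = refl
  sumL-filter (x ∷ xs) with f x ℤ.≟ 0ℤ
  ... | yes fx≡0 = trans (sumL-filter xs) (sym (trans (cong (ℤ._+ sumL f xs) fx≡0) (ℤₚ.+-identityˡ _)))
  ... | no  _    = cong (λ s → f x ℤ.+ s) (sumL-filter xs)

  -- Without their zero terms both lists are duplicate-free with the same members, hence
  -- permutations of each other.
  sumL-support : ∀ {xs ys} → Unique xs → Unique ys →
    (∀ x → f x ≢ 0ℤ → x ∈ xs) → (∀ x → f x ≢ 0ℤ → x ∈ ys) → sumL f xs ≡ sumL f ys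
  sumL-support {xs} {ys} xs! ys! ⊆xs ⊆ys = trans (sym (sumL-filter xs)) (trans
    (sumL-↭ f (∼bag⇒↭ (unique∧set⇒bag
      (Unique.filter⁺ nonzero? xs!) (Unique.filter⁺ nonzero? ys!)
      (mk⇔ (transfer {xs} ⊆ys) (transfer {ys} ⊆xs)))))
    (sumL-filter ys))
    where
    transfer : ∀ {xs ys} → (∀ x → f x ≢ 0ℤ → x ∈ ys) →
               ∀ {x} → x ∈ filter nonzero? xs → x ∈ filter nonzero? ys
    transfer {xs} ⊆ys x∈ with ∈-filter⁻ nonzero? {xs = xs} x∈
    ... | _ , fx≢0 = ∈-filter⁺ nonzero? (⊆ys _ fx≢0) fx≢0

-- Substitution in a sum over an infinite index type: `g` is a bijection of the whole types, while
-- the lists need only cover the support.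
sumL-reindex : ∀ (f : A → ℤ) (g : B → A) {xs ys} → Unique xs → Unique ys →
  (∀ {y y′} → g y ≡ g y′ → y ≡ y′) → (∀ x → ∃ λ y → g y ≡ x) →
  (∀ x → f x ≢ 0ℤ → x ∈ xs) → (∀ y → f (g y) ≢ 0ℤ → y ∈ ys) →
  sumL f xs ≡ sumL (f ∘ g) ys
sumL-reindex f g {xs} {ys} xs! ys! inj surj ⊆xs ⊆ys = trans
  (sumL-support f xs! (Unique.map⁺ inj ys!) ⊆xs ⊆gys) (sumL-map f g ys)
  where
  ⊆gys : ∀ x → f x ≢ 0ℤ → x ∈ map g ys
  ⊆gys x fx≢0 with surj x
  ... | y , refl = ∈-map⁺ g (⊆ys y fx≢0)

∑L : (A → PS) → List A → PS
∑L F []       = zeroPS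
∑L F (x ∷ xs) = F x ⊕ ∑L F xs

∑L-coeff : ∀ (F : A → PS) xs n → ∑L F xs n ≡ sumL (λ x → F x n) xs
∑L-coeff F []       n = refl
∑L-coeff F (x ∷ xs) n = trans (⊕-coeff (F x) (∑L F xs) n) (cong (λ s → F x n ℤ.+ s) (∑L-coeff F xs n))

∑-sumTo : ∀ F n i → ∑ F n i ≡ sumTo (λ k → F k i) n
∑-sumTo F zero    i = refl
∑-sumTo F (suc n) i = trans (⊕-coeff (∑ F n) (F n) i) (cong (ℤ._+ F n i) (∑-sumTo F n i))

module _ {N : ℕ} where
  open Ring {N} using (+-cong; +-assoc; +-identityˡ; zeroˡ; zeroʳ; distribˡ; distribʳ)

  ∑L-cong : ∀ {F G : A → PS} → (∀ x → F x ≈[ N ] G x) → ∀ xs → ∑L F xs ≈[ N ] ∑L G xs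
  ∑L-cong eq []       = Ring.refl
  ∑L-cong eq (x ∷ xs) = +-cong (eq x) (∑L-cong eq xs)

  ∑L-++ : ∀ (F : A → PS) xs ys → ∑L F (xs ++ ys) ≈[ N ] ∑L F xs ⊕ ∑L F ys
  ∑L-++ F []       ys = Ring.sym (+-identityˡ _)
  ∑L-++ F (x ∷ xs) ys = Ring.trans (+-cong Ring.refl (∑L-++ F xs ys)) (Ring.sym (+-assoc _ _ _))

  ∑L-⊗ˡ : ∀ h (F : A → PS) xs → ∑L (λ x → h ⊗ F x) xs ≈[ N ] h ⊗ ∑L F xs
  ∑L-⊗ˡ h F []       = Ring.sym (zeroʳ h)
  ∑L-⊗ˡ h F (x ∷ xs) = Ring.trans (+-cong Ring.refl (∑L-⊗ˡ h F xs)) (Ring.sym (distribˡ h _ _))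

  ∑L-map : ∀ (F : A → PS) (g : B → A) xs → ∑L F (map g xs) ≈[ N ] ∑L (F ∘ g) xs
  ∑L-map F g []       = Ring.refl
  ∑L-map F g (x ∷ xs) = +-cong Ring.refl (∑L-map F g xs)

  ∑L-product : ∀ (F : A → PS) (G : B → PS) xs ys →
    ∑L (λ (x , y) → F x ⊗ G y) (cartesianProduct xs ys) ≈[ N ] ∑L F xs ⊗ ∑L G ys
  ∑L-product F G []       ys = Ring.sym (zeroˡ _)
  ∑L-product F G (x ∷ xs) ys = Ring.trans (∑L-++ _ (map (x ,_) ys) _)
    (Ring.trans (+-cong (Ring.trans (∑L-map _ (x ,_) ys) (∑L-⊗ˡ (F x) G ys)) (∑L-product F G xs ys))
      (Ring.sym (distribʳ _ _ _)))

-- Intervals of integers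

ints : ℕ → List ℤ
ints K = map (_⊖ K) (upTo (suc (K ℕ.+ K)))

ints-unique : ∀ K → Unique (ints K)
ints-unique K = Unique.map⁺ (ℤₚ.+-injective ∘ cancel) (Unique.upTo⁺ (suc (K ℕ.+ K)))
  where
  cancel : ∀ {k l} → k ⊖ K ≡ l ⊖ K → + k ≡ + l
  cancel {k} {l} eq = ∙-cancelʳ (- + K) (+ k) (+ l)
    (trans (ℤₚ.m-n≡m⊖n k K) (trans eq (sym (ℤₚ.m-n≡m⊖n l K))))

∈-ints : ∀ {K} m → ∣ m ∣ ≤ K → m ∈ ints K
∈-ints {K} (+ n) n≤K = subst (_∈ ints K) ([m+n]⊖m K n)
  (∈-map⁺ (_⊖ K) (∈-upTo⁺ (s≤s (ℕₚ.+-monoʳ-≤ K n≤K))))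
∈-ints {K} -[1+ n ] n<K with ℕₚ.m≤n⇒∃[o]m+o≡n n<K
... | l , refl = subst (_∈ ints (suc n ℕ.+ l))
  (trans (cong (l ⊖_) (ℕₚ.+-comm (suc n) l)) (m⊖[m+n] l (suc n)))
  (∈-map⁺ (_⊖ (suc n ℕ.+ l)) (∈-upTo⁺
    (s≤s (ℕₚ.≤-trans (ℕₚ.m≤n+m l (suc n)) (ℕₚ.m≤m+n (suc n ℕ.+ l) _)))))

theta-∑L : ∀ {N} c p r K → theta c p r K ≈[ N ] ∑L (thetaTerm c p r) (ints K)
theta-∑L c p r K = exact λ n → begin
  ∑ (λ k → thetaTerm c p r (k ⊖ K)) (suc (K ℕ.+ K)) n
    ≡⟨ ∑-sumTo _ (suc (K ℕ.+ K)) n ⟩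
  sumTo (λ k → thetaTerm c p r (k ⊖ K) n) (suc (K ℕ.+ K))
    ≡⟨ sumTo-sumL _ (suc (K ℕ.+ K)) ⟩
  sumL (λ k → thetaTerm c p r (k ⊖ K) n) (upTo (suc (K ℕ.+ K)))
    ≡⟨ sumL-map (λ m → thetaTerm c p r m n) (_⊖ K) (upTo (suc (K ℕ.+ K))) ⟨
  sumL (λ m → thetaTerm c p r m n) (ints K)
    ≡⟨ ∑L-coeff (thetaTerm c p r) (ints K) n ⟨
  ∑L (thetaTerm c p r) (ints K) n ∎
  where open ≡-Reasoning

-- The product of two theta series

parity : ℤ → ℤ
parity m = -1ℤ ℤ.^ ∣ m ∣

private
  cancel-signs : ∀ x y → x ℤ.* y ≡ -1ℤ ℤ.* x ℤ.* (-1ℤ ℤ.* y)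
  cancel-signs = solve-∀

parity-⊖ : ∀ m n → parity (m ⊖ n) ≡ -1ℤ ℤ.^ m ℤ.* -1ℤ ℤ.^ n
parity-⊖ m       zero    = sym (ℤₚ.*-identityʳ _)
parity-⊖ zero    (suc n) = sym (ℤₚ.*-identityˡ _)
parity-⊖ (suc m) (suc n) = trans (cong parity (ℤₚ.[1+m]⊖[1+n]≡m⊖n m n))
  (trans (parity-⊖ m n) (cancel-signs (-1ℤ ℤ.^ m) (-1ℤ ℤ.^ n)))

parity-+ : ∀ i j → parity (i ℤ.+ j) ≡ parity i ℤ.* parity j
parity-+ (+ m)    (+ n)    = ℤₚ.^-distribˡ-+-* -1ℤ m n
parity-+ (+ m)    -[1+ n ] = parity-⊖ m (suc n)
parity-+ -[1+ m ] (+ n)    = trans (parity-⊖ n (suc m)) (ℤₚ.*-comm (-1ℤ ℤ.^ n) _)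
parity-+ -[1+ m ] -[1+ n ] = trans
  (cong (λ x → -1ℤ ℤ.* (-1ℤ ℤ.* x)) (ℤₚ.^-distribˡ-+-* -1ℤ m n))
  (regroup (-1ℤ ℤ.^ m) (-1ℤ ℤ.^ n))
  where
  regroup : ∀ x y → -1ℤ ℤ.* (-1ℤ ℤ.* (x ℤ.* y)) ≡ -1ℤ ℤ.* x ℤ.* (-1ℤ ℤ.* y)
  regroup = solve-∀

parity-- : ∀ i j → parity (i ℤ.- j) ≡ parity i ℤ.* parity j
parity-- i j = trans (parity-+ i (- j)) (cong (λ n → parity i ℤ.* -1ℤ ℤ.^ n) (ℤₚ.∣-i∣≡∣i∣ j))

tri-double : ∀ n → + tri n ℤ.* + 2 ≡ + n ℤ.* (+ n ℤ.+ 1ℤ)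
tri-double zero    = refl
tri-double (suc n) = begin
  + (suc n ℕ.+ tri n) ℤ.* + 2                       ≡⟨ ℤₚ.*-distribʳ-+ (+ 2) (+ suc n) (+ tri n) ⟩
  + suc n ℤ.* + 2 ℤ.+ + tri n ℤ.* + 2               ≡⟨ cong (λ x → + suc n ℤ.* + 2 ℤ.+ x) (tri-double n) ⟩
  (1ℤ ℤ.+ + n) ℤ.* + 2 ℤ.+ + n ℤ.* (+ n ℤ.+ 1ℤ)     ≡⟨ step (+ n) ⟩
  (1ℤ ℤ.+ + n) ℤ.* (1ℤ ℤ.+ + n ℤ.+ 1ℤ)              ∎
  where
  open ≡-Reasoning
  step : ∀ x → (1ℤ ℤ.+ x) ℤ.* + 2 ℤ.+ x ℤ.* (x ℤ.+ 1ℤ) ≡ (1ℤ ℤ.+ x) ℤ.* (1ℤ ℤ.+ x ℤ.+ 1ℤ)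
  step = solve-∀

-- Twice `quad`: doubling clears the halves of the triangular numbers and leaves one polynomial for
-- both signs of m, accessible to the ring solver.
quadℤ : ℕ → ℕ → ℤ → ℤ
quadℤ p r m = (+ p ℤ.+ + r) ℤ.* (m ℤ.* m) ℤ.+ (+ p ℤ.- + r) ℤ.* m

quad-double : ∀ p r m → + quad p r m ℤ.* + 2 ≡ quadℤ p r m
quad-double p r m = trans (expand m) (closed m)
  where
  t₁ t₂ : ℤ → ℕ
  t₁ (+ n)    = tri n
  t₁ -[1+ n ] = tri n
  t₂ (+ n)    = tri (pred n)
  t₂ -[1+ n ] = tri (suc n)

  double₁ : ∀ m → + t₁ m ℤ.* + 2 ≡ m ℤ.* (m ℤ.+ 1ℤ)
  double₁ (+ n)    = tri-double n
  double₁ -[1+ n ] = trans (tri-double n) (reflect (+ n))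
    where
    reflect : ∀ x → x ℤ.* (x ℤ.+ 1ℤ) ≡ - (1ℤ ℤ.+ x) ℤ.* (- (1ℤ ℤ.+ x) ℤ.+ 1ℤ)
    reflect = solve-∀

  double₂ : ∀ m → + t₂ m ℤ.* + 2 ≡ m ℤ.* (m ℤ.- 1ℤ)
  double₂ (+ zero)  = refl
  double₂ (+ suc n) = trans (tri-double n) (shift (+ n))
    where
    shift : ∀ x → x ℤ.* (x ℤ.+ 1ℤ) ≡ (1ℤ ℤ.+ x) ℤ.* (1ℤ ℤ.+ x ℤ.- 1ℤ)
    shift = solve-∀
  double₂ -[1+ n ]  = trans (tri-double (suc n)) (reflect (+ suc n))
    where
    reflect : ∀ x → x ℤ.* (x ℤ.+ 1ℤ) ≡ - x ℤ.* (- x ℤ.- 1ℤ)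
    reflect = solve-∀

  expand : ∀ m → + quad p r m ℤ.* + 2 ≡ (+ p ℤ.* + t₁ m ℤ.+ + r ℤ.* + t₂ m) ℤ.* + 2
  expand (+ n)    = cong (ℤ._* + 2) (cong₂ ℤ._+_ (ℤₚ.pos-* p (tri n)) (ℤₚ.pos-* r (tri (pred n))))
  expand -[1+ n ] = cong (ℤ._* + 2) (cong₂ ℤ._+_ (ℤₚ.pos-* p (tri n)) (ℤₚ.pos-* r (tri (suc n))))

  closed : ∀ m → (+ p ℤ.* + t₁ m ℤ.+ + r ℤ.* + t₂ m) ℤ.* + 2 ≡ quadℤ p r m
  closed m = begin
    (+ p ℤ.* + t₁ m ℤ.+ + r ℤ.* + t₂ m) ℤ.* + 2
      ≡⟨ distribute (+ p) (+ r) (+ t₁ m) (+ t₂ m) (+ 2) ⟩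
    + p ℤ.* (+ t₁ m ℤ.* + 2) ℤ.+ + r ℤ.* (+ t₂ m ℤ.* + 2)
      ≡⟨ cong₂ (λ x y → + p ℤ.* x ℤ.+ + r ℤ.* y) (double₁ m) (double₂ m) ⟩
    + p ℤ.* (m ℤ.* (m ℤ.+ 1ℤ)) ℤ.+ + r ℤ.* (m ℤ.* (m ℤ.- 1ℤ))
      ≡⟨ collect (+ p) (+ r) m ⟩
    quadℤ p r m ∎
    where
    open ≡-Reasoning
    distribute : ∀ p r x y c → (p ℤ.* x ℤ.+ r ℤ.* y) ℤ.* c ≡ p ℤ.* (x ℤ.* c) ℤ.+ r ℤ.* (y ℤ.* c)
    distribute = solve-∀
    collect : ∀ p r m → p ℤ.* (m ℤ.* (m ℤ.+ 1ℤ)) ℤ.+ r ℤ.* (m ℤ.* (m ℤ.- 1ℤ)) ≡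
              (p ℤ.+ r) ℤ.* (m ℤ.* m) ℤ.+ (p ℤ.- r) ℤ.* m
    collect = solve-∀

halve : ∀ a b → + a ℤ.* + 2 ≡ + b ℤ.* + 2 → a ≡ b
halve a b eq = ℤₚ.+-injective (ℤₚ.*-cancelʳ-≡ (+ a) (+ b) (+ 2) eq)

-- Unlike `abs≤quad` this admits r = 0. The extra 1 is then necessary, since `quad p 0` vanishes at
-- m = -1.
abs≤1+quad : ∀ p r m → ∣ m ∣ ≤ suc (quad (suc p) r m)
abs≤1+quad p r (+ n)    = ℕₚ.m≤n⇒m≤1+n (ℕₚ.≤-trans (n≤tri n)
  (ℕₚ.≤-trans (ℕₚ.m≤m+n (tri n) (p ℕ.* tri n)) (ℕₚ.m≤m+n _ _)))
abs≤1+quad p r -[1+ n ] = s≤s (ℕₚ.≤-trans (n≤tri n)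
  (ℕₚ.≤-trans (ℕₚ.m≤m+n (tri n) (p ℕ.* tri n)) (ℕₚ.m≤m+n _ _)))

-- The exponents pair up under v ↦ -1-v with opposite signs.
theta-vanishes : ∀ {N} → theta -1ℤ 60 0 N ≈[ N ] zeroPS
theta-vanishes {N} = Ring.trans (theta-∑L -1ℤ 60 0 N)
  (modulo λ n n<N → trans (∑L-coeff (thetaTerm -1ℤ 60 0) (ints N) n)
    (self-opposite (sumL (f n) (ints N)) (trans
      (sumL-reindex (f n) σ (ints-unique N) (ints-unique N)
        (λ {m} {m′} eq → trans (sym (σσ m)) (trans (cong σ eq) (σσ m′)))
        (λ m → σ m , σσ m)
        (λ m → bounded n n<N m)
        (λ m fσm≢0 → bounded n n<N m λ fm≡0 →
          fσm≢0 (trans (f∘σ n m) (cong -_ fm≡0))))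
      (trans (sumL-cong (f∘σ n) (ints N)) (sumL-neg (f n) (ints N))))))
  where
  f : ℕ → ℤ → ℤ
  f n m = thetaTerm -1ℤ 60 0 m n

  σ : ℤ → ℤ
  σ m = -1ℤ ℤ.- m

  σσ : ∀ m → -1ℤ ℤ.- (-1ℤ ℤ.- m) ≡ m
  σσ = solve-∀

  f∘σ : ∀ n m → f n (σ m) ≡ - f n m
  f∘σ n m = trans (cong₂ (λ s e → mono s e n)
      (trans (parity-- -1ℤ m) (ℤₚ.-1*i≡-i (parity m)))
      (halve (quad 60 0 (σ m)) (quad 60 0 m)
        (trans (quad-double 60 0 (σ m)) (trans (symmetric m) (sym (quad-double 60 0 m))))))
    (mono-neg (parity m) (quad 60 0 m) n)
    where
    symmetric : ∀ m → (+ 60 ℤ.+ + 0) ℤ.* ((-1ℤ ℤ.- m) ℤ.* (-1ℤ ℤ.- m)) ℤ.+ (+ 60 ℤ.- + 0) ℤ.* (-1ℤ ℤ.- m) ≡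
                (+ 60 ℤ.+ + 0) ℤ.* (m ℤ.* m) ℤ.+ (+ 60 ℤ.- + 0) ℤ.* m
    symmetric = solve-∀

  bounded : ∀ n → n < N → ∀ m → f n m ≢ 0ℤ → m ∈ ints N
  bounded n n<N m fm≢0 = ∈-ints m (ℕₚ.≤-trans (abs≤1+quad 59 0 m)
    (ℕₚ.≤-trans (s≤s (ℕₚ.≤-reflexive (mono-degree _ _ fm≢0))) n<N))

  self-opposite : ∀ x → x ≡ - x → x ≡ 0ℤ
  self-opposite (+ zero) _ = refl

-- The three cosets of {(m , n) : m ≡ n mod 3}, parametrised so that the form
-- quad 9 1 m + quad 8 12 n splits as shift + quad _ _ u + quad _ _ v.
coset : Fin 3 × ℤ × ℤ → ℤ × ℤ
coset (0F , u , v) = u ℤ.+ + 2 ℤ.* v , u ℤ.- v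
coset (1F , u , v) = - (u ℤ.+ + 2 ℤ.* v ℤ.+ 1ℤ) , v ℤ.- u
coset (2F , u , v) = u ℤ.+ + 2 ℤ.* v ℤ.+ 1ℤ , u ℤ.- v

-- m - n and m + 2n on the coset.
residue : Fin 3 → ℤ → ℤ
residue 0F x = + 3 ℤ.* x
residue 1F x = - (+ 3 ℤ.* x ℤ.+ 1ℤ)
residue 2F x = + 3 ℤ.* x ℤ.+ 1ℤ

multiple-of-3 : ∀ x k → + 3 ℤ.* x ≡ k → 3 ∣ ∣ k ∣
multiple-of-3 x _ refl = divides ∣ x ∣ (trans (ℤₚ.abs-* (+ 3) x) (ℕₚ.*-comm 3 ∣ x ∣))

residue-0≢1 : ∀ x y → residue 0F x ≢ residue 1F y
residue-0≢1 x y eq = from-no (3 ∣? 1) (multiple-of-3 (x ℤ.+ y) -1ℤ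
  (trans (ℤₚ.*-distribˡ-+ (+ 3) x y) (trans (cong (ℤ._+ + 3 ℤ.* y) eq) (simplify y))))
  where
  simplify : ∀ y → - (+ 3 ℤ.* y ℤ.+ 1ℤ) ℤ.+ + 3 ℤ.* y ≡ -1ℤ
  simplify = solve-∀

residue-0≢2 : ∀ x y → residue 0F x ≢ residue 2F y
residue-0≢2 x y eq = from-no (3 ∣? 1) (multiple-of-3 (x ℤ.- y) 1ℤ
  (trans (expand x y) (trans (cong (ℤ._- + 3 ℤ.* y) eq) (simplify y))))
  where
  expand : ∀ x y → + 3 ℤ.* (x ℤ.- y) ≡ + 3 ℤ.* x ℤ.- + 3 ℤ.* y
  expand = solve-∀
  simplify : ∀ y → + 3 ℤ.* y ℤ.+ 1ℤ ℤ.- + 3 ℤ.* y ≡ 1ℤ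
  simplify = solve-∀

residue-1≢2 : ∀ x y → residue 1F x ≢ residue 2F y
residue-1≢2 x y eq = from-no (3 ∣? 2) (multiple-of-3 (x ℤ.+ y) (- + 2)
  (trans (expand x y) (trans (cong (λ z → + 3 ℤ.* x ℤ.+ (z ℤ.- 1ℤ)) (sym eq)) (simplify x))))
  where
  expand : ∀ x y → + 3 ℤ.* (x ℤ.+ y) ≡ + 3 ℤ.* x ℤ.+ (+ 3 ℤ.* y ℤ.+ 1ℤ ℤ.- 1ℤ)
  expand = solve-∀
  simplify : ∀ x → + 3 ℤ.* x ℤ.+ (- (+ 3 ℤ.* x ℤ.+ 1ℤ) ℤ.- 1ℤ) ≡ - + 2
  simplify = solve-∀

residue-injective : ∀ i j {x y} → residue i x ≡ residue j y → i ≡ j × x ≡ y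
residue-injective 0F 0F {x} {y} eq = refl , ℤₚ.*-cancelˡ-≡ (+ 3) x y eq
residue-injective 1F 1F {x} {y} eq =
  refl , ℤₚ.*-cancelˡ-≡ (+ 3) x y (∙-cancelʳ 1ℤ _ _ (ℤₚ.neg-injective eq))
residue-injective 2F 2F {x} {y} eq =
  refl , ℤₚ.*-cancelˡ-≡ (+ 3) x y (∙-cancelʳ 1ℤ _ _ eq)
residue-injective 0F 1F {x} {y} eq = contradiction eq (residue-0≢1 x y)
residue-injective 1F 0F {x} {y} eq = contradiction (sym eq) (residue-0≢1 y x)
residue-injective 0F 2F {x} {y} eq = contradiction eq (residue-0≢2 x y)
residue-injective 2F 0F {x} {y} eq = contradiction (sym eq) (residue-0≢2 y x)
residue-injective 1F 2F {x} {y} eq = contradiction eq (residue-1≢2 x y)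
residue-injective 2F 1F {x} {y} eq = contradiction (sym eq) (residue-1≢2 y x)

residue-surjective : ∀ x → ∃ λ i → ∃ λ v → residue i v ≡ x
residue-surjective x = go (x %ℕ 3) (n%ℕd<d x 3) (a≡a%ℕn+[a/ℕn]*n x 3)
  where
  go : ∀ ρ → ρ < 3 → x ≡ + ρ ℤ.+ (x /ℕ 3) ℤ.* + 3 → ∃ λ i → ∃ λ v → residue i v ≡ x
  go 0 _ eq = 0F , x /ℕ 3 , trans (lemma (x /ℕ 3)) (sym eq)
    where
    lemma : ∀ q → + 3 ℤ.* q ≡ + 0 ℤ.+ q ℤ.* + 3
    lemma = solve-∀
  go 1 _ eq = 2F , x /ℕ 3 , trans (lemma (x /ℕ 3)) (sym eq)
    where
    lemma : ∀ q → + 3 ℤ.* q ℤ.+ 1ℤ ≡ + 1 ℤ.+ q ℤ.* + 3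
    lemma = solve-∀
  -- The remainder 2 is the negated class: 3q + 2 = -(3(-1-q) + 1).
  go 2 _ eq = 1F , -1ℤ ℤ.- x /ℕ 3 , trans (lemma (x /ℕ 3)) (sym eq)
    where
    lemma : ∀ q → - (+ 3 ℤ.* (-1ℤ ℤ.- q) ℤ.+ 1ℤ) ≡ + 2 ℤ.+ q ℤ.* + 3
    lemma = solve-∀
  go (suc (suc (suc _))) (s≤s (s≤s (s≤s ()))) _

coset-difference : ∀ i u v → let (m , n) = coset (i , u , v) in m ℤ.- n ≡ residue i v
coset-difference 0F = lemma
  where
  lemma : ∀ u v → u ℤ.+ + 2 ℤ.* v ℤ.- (u ℤ.- v) ≡ + 3 ℤ.* v
  lemma = solve-∀
coset-difference 1F = lemma
  where
  lemma : ∀ u v → - (u ℤ.+ + 2 ℤ.* v ℤ.+ 1ℤ) ℤ.- (v ℤ.- u) ≡ - (+ 3 ℤ.* v ℤ.+ 1ℤ)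
  lemma = solve-∀
coset-difference 2F = lemma
  where
  lemma : ∀ u v → u ℤ.+ + 2 ℤ.* v ℤ.+ 1ℤ ℤ.- (u ℤ.- v) ≡ + 3 ℤ.* v ℤ.+ 1ℤ
  lemma = solve-∀

coset-sum : ∀ i u v → let (m , n) = coset (i , u , v) in m ℤ.+ + 2 ℤ.* n ≡ residue i u
coset-sum 0F = lemma
  where
  lemma : ∀ u v → u ℤ.+ + 2 ℤ.* v ℤ.+ + 2 ℤ.* (u ℤ.- v) ≡ + 3 ℤ.* u
  lemma = solve-∀
coset-sum 1F = lemma
  where
  lemma : ∀ u v → - (u ℤ.+ + 2 ℤ.* v ℤ.+ 1ℤ) ℤ.+ + 2 ℤ.* (v ℤ.- u) ≡ - (+ 3 ℤ.* u ℤ.+ 1ℤ)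
  lemma = solve-∀
coset-sum 2F = lemma
  where
  lemma : ∀ u v → u ℤ.+ + 2 ℤ.* v ℤ.+ 1ℤ ℤ.+ + 2 ℤ.* (u ℤ.- v) ≡ + 3 ℤ.* u ℤ.+ 1ℤ
  lemma = solve-∀

-- The combination m - n recovers the class and v, and m + 2n recovers u.
coset-injective : ∀ {y y′} → coset y ≡ coset y′ → y ≡ y′
coset-injective {i , u , v} {j , u′ , v′} eq
  with residue-injective i j (trans (sym (coset-difference i u v))
         (trans (cong (λ (m , n) → m ℤ.- n) eq) (coset-difference j u′ v′)))
     | residue-injective i j (trans (sym (coset-sum i u v))
         (trans (cong (λ (m , n) → m ℤ.+ + 2 ℤ.* n) eq) (coset-sum j u′ v′)))
... | refl , refl | _ , refl = refl

private
  restore : ∀ m n → n ℤ.+ (m ℤ.- n) ≡ m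
  restore = solve-∀

coset-surjective : ∀ x → ∃ λ y → coset y ≡ x
coset-surjective (m , n) with residue-surjective (m ℤ.- n)
... | 0F , v , eq = (0F , n ℤ.+ v , v) , cong₂ _,_
  (trans (first n v) (trans (cong (λ x → n ℤ.+ x) eq) (restore m n))) (second n v)
  where
  first : ∀ n v → n ℤ.+ v ℤ.+ + 2 ℤ.* v ≡ n ℤ.+ + 3 ℤ.* v
  first = solve-∀
  second : ∀ n v → n ℤ.+ v ℤ.- v ≡ n
  second = solve-∀
... | 1F , v , eq = (1F , v ℤ.- n , v) , cong₂ _,_
  (trans (first n v) (trans (cong (λ x → n ℤ.+ x) eq) (restore m n))) (second n v)
  where
  first : ∀ n v → - (v ℤ.- n ℤ.+ + 2 ℤ.* v ℤ.+ 1ℤ) ≡ n ℤ.+ - (+ 3 ℤ.* v ℤ.+ 1ℤ)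
  first = solve-∀
  second : ∀ n v → v ℤ.- (v ℤ.- n) ≡ n
  second = solve-∀
... | 2F , v , eq = (2F , n ℤ.+ v , v) , cong₂ _,_
  (trans (first n v) (trans (cong (λ x → n ℤ.+ x) eq) (restore m n))) (second n v)
  where
  first : ∀ n v → n ℤ.+ v ℤ.+ + 2 ℤ.* v ℤ.+ 1ℤ ≡ n ℤ.+ (+ 3 ℤ.* v ℤ.+ 1ℤ)
  first = solve-∀
  second : ∀ n v → n ℤ.+ v ℤ.- v ≡ n
  second = solve-∀

-- The value of 5m² + 4m + 10n² - 2n at u = v = 0, that is at the points (0, 0), (-1, 0) and (1, 0).
shift : Fin 3 → ℕ
shift 0F = 0
shift 1F = 1
shift 2F = 9

formᵤ : Fin 3 → ℤ → ℕ
formᵤ 0F = quad 17 13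
formᵤ 1F = quad 23 7
formᵤ 2F = quad 27 3

-- The negated parametrisation of class `1F` gives it the same form in v as class `0F`, so that the
-- two share a theta factor. In class `2F` the form 30v² + 30v is symmetric about -1/2.
formᵥ : Fin 3 → ℤ → ℕ
formᵥ 0F = quad 40 20
formᵥ 1F = quad 40 20
formᵥ 2F = quad 60 0

coset-parity : ∀ i u v → parity (proj₂ (coset (i , u , v))) ≡ parity u ℤ.* parity v
coset-parity 0F u v = parity-- u v
coset-parity 1F u v = trans (parity-- v u) (ℤₚ.*-comm (parity v) (parity u))
coset-parity 2F u v = parity-- u v

private
  split-form : ∀ p r p′ r′ p₁ r₁ p₂ r₂ s m n u v →
    quadℤ p r m ℤ.+ quadℤ p′ r′ n ≡ + s ℤ.* + 2 ℤ.+ (quadℤ p₁ r₁ u ℤ.+ quadℤ p₂ r₂ v) →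
    quad p r m ℕ.+ quad p′ r′ n ≡ s ℕ.+ (quad p₁ r₁ u ℕ.+ quad p₂ r₂ v)
  split-form p r p′ r′ p₁ r₁ p₂ r₂ s m n u v eq = halve _ _ (begin
    (+ quad p r m ℤ.+ + quad p′ r′ n) ℤ.* + 2
      ≡⟨ ℤₚ.*-distribʳ-+ (+ 2) (+ quad p r m) (+ quad p′ r′ n) ⟩
    + quad p r m ℤ.* + 2 ℤ.+ + quad p′ r′ n ℤ.* + 2
      ≡⟨ cong₂ ℤ._+_ (quad-double p r m) (quad-double p′ r′ n) ⟩
    quadℤ p r m ℤ.+ quadℤ p′ r′ n
      ≡⟨ eq ⟩
    + s ℤ.* + 2 ℤ.+ (quadℤ p₁ r₁ u ℤ.+ quadℤ p₂ r₂ v)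
      ≡⟨ cong₂ (λ x y → + s ℤ.* + 2 ℤ.+ (x ℤ.+ y)) (quad-double p₁ r₁ u) (quad-double p₂ r₂ v) ⟨
    + s ℤ.* + 2 ℤ.+ (+ quad p₁ r₁ u ℤ.* + 2 ℤ.+ + quad p₂ r₂ v ℤ.* + 2)
      ≡⟨ distribute (+ s) (+ quad p₁ r₁ u) (+ quad p₂ r₂ v) (+ 2) ⟨
    (+ s ℤ.+ (+ quad p₁ r₁ u ℤ.+ + quad p₂ r₂ v)) ℤ.* + 2 ∎)
    where
    open ≡-Reasoning
    distribute : ∀ s x y c → (s ℤ.+ (x ℤ.+ y)) ℤ.* c ≡ s ℤ.* c ℤ.+ (x ℤ.* c ℤ.+ y ℤ.* c)
    distribute = solve-∀

-- The cross terms 20uv and -20uv cancel. Each `lemma` is the doubled identity with the coefficients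
-- p + r and p - r of `quadℤ` evaluated.
coset-form : ∀ i u v → let (m , n) = coset (i , u , v) in
  quad 9 1 m ℕ.+ quad 8 12 n ≡ shift i ℕ.+ (formᵤ i u ℕ.+ formᵥ i v)
coset-form 0F u v = split-form 9 1 8 12 17 13 40 20 0 (u ℤ.+ + 2 ℤ.* v) (u ℤ.- v) u v (lemma u v)
  where
  lemma : ∀ u v →
    + 10 ℤ.* ((u ℤ.+ + 2 ℤ.* v) ℤ.* (u ℤ.+ + 2 ℤ.* v)) ℤ.+ + 8 ℤ.* (u ℤ.+ + 2 ℤ.* v) ℤ.+
    (+ 20 ℤ.* ((u ℤ.- v) ℤ.* (u ℤ.- v)) ℤ.+ - + 4 ℤ.* (u ℤ.- v)) ≡
    + 0 ℤ.+ ((+ 30 ℤ.* (u ℤ.* u) ℤ.+ + 4 ℤ.* u) ℤ.+ (+ 60 ℤ.* (v ℤ.* v) ℤ.+ + 20 ℤ.* v))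
  lemma = solve-∀
coset-form 1F u v = split-form 9 1 8 12 23 7 40 20 1 (- (u ℤ.+ + 2 ℤ.* v ℤ.+ 1ℤ)) (v ℤ.- u) u v (lemma u v)
  where
  lemma : ∀ u v →
    + 10 ℤ.* (- (u ℤ.+ + 2 ℤ.* v ℤ.+ 1ℤ) ℤ.* - (u ℤ.+ + 2 ℤ.* v ℤ.+ 1ℤ)) ℤ.+
    + 8 ℤ.* - (u ℤ.+ + 2 ℤ.* v ℤ.+ 1ℤ) ℤ.+
    (+ 20 ℤ.* ((v ℤ.- u) ℤ.* (v ℤ.- u)) ℤ.+ - + 4 ℤ.* (v ℤ.- u)) ≡
    + 2 ℤ.+ ((+ 30 ℤ.* (u ℤ.* u) ℤ.+ + 16 ℤ.* u) ℤ.+ (+ 60 ℤ.* (v ℤ.* v) ℤ.+ + 20 ℤ.* v))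
  lemma = solve-∀
coset-form 2F u v = split-form 9 1 8 12 27 3 60 0 9 (u ℤ.+ + 2 ℤ.* v ℤ.+ 1ℤ) (u ℤ.- v) u v (lemma u v)
  where
  lemma : ∀ u v →
    + 10 ℤ.* ((u ℤ.+ + 2 ℤ.* v ℤ.+ 1ℤ) ℤ.* (u ℤ.+ + 2 ℤ.* v ℤ.+ 1ℤ)) ℤ.+
    + 8 ℤ.* (u ℤ.+ + 2 ℤ.* v ℤ.+ 1ℤ) ℤ.+
    (+ 20 ℤ.* ((u ℤ.- v) ℤ.* (u ℤ.- v)) ℤ.+ - + 4 ℤ.* (u ℤ.- v)) ≡
    + 18 ℤ.+ ((+ 30 ℤ.* (u ℤ.* u) ℤ.+ + 24 ℤ.* u) ℤ.+ (+ 60 ℤ.* (v ℤ.* v) ℤ.+ + 60 ℤ.* v))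
  lemma = solve-∀

formᵤ-bound : ∀ i u → ∣ u ∣ ≤ suc (formᵤ i u)
formᵤ-bound 0F = abs≤1+quad 16 13
formᵤ-bound 1F = abs≤1+quad 22 7
formᵤ-bound 2F = abs≤1+quad 26 3

formᵥ-bound : ∀ i v → ∣ v ∣ ≤ suc (formᵥ i v)
formᵥ-bound 0F = abs≤1+quad 39 20
formᵥ-bound 1F = abs≤1+quad 39 20
formᵥ-bound 2F = abs≤1+quad 59 0

private
  twoThetas : ℤ × ℤ → PS
  twoThetas (m , n) = mono (1ℤ ℤ.^ ∣ m ∣ ℤ.* parity n) (quad 9 1 m ℕ.+ quad 8 12 n)

  splitThetas : Fin 3 × ℤ × ℤ → PS
  splitThetas (i , u , v) = mono (1ℤ ℤ.* (parity u ℤ.* parity v)) (shift i ℕ.+ (formᵤ i u ℕ.+ formᵥ i v))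

  twoThetas-coset : ∀ y → twoThetas (coset y) ≡ splitThetas y
  twoThetas-coset (i , u , v) = cong₂ mono
    (cong₂ ℤ._*_ (ℤₚ.^-zeroˡ ∣ proj₁ (coset (i , u , v)) ∣) (coset-parity i u v))
    (coset-form i u v)

  pairs : ℕ → List (ℤ × ℤ)
  pairs N = cartesianProduct (ints N) (ints N)

  pairs-unique : ∀ N → Unique (pairs N)
  pairs-unique N = Unique.cartesianProduct⁺ (ints-unique N) (ints-unique N)

  triples : ℕ → List (Fin 3 × ℤ × ℤ)
  triples N = cartesianProduct (allFin 3) (pairs N)

twoThetas-reindex : ∀ {N} →
  ∑L twoThetas (pairs N) ≈[ N ] ∑L splitThetas (triples N)
twoThetas-reindex {N} = modulo λ n n<N → begin
  ∑L twoThetas (pairs N) n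
    ≡⟨ ∑L-coeff twoThetas (pairs N) n ⟩
  sumL (λ x → twoThetas x n) (pairs N)
    ≡⟨ sumL-reindex (λ x → twoThetas x n) coset
         (pairs-unique N) (Unique.cartesianProduct⁺ (Unique.allFin⁺ 3) (pairs-unique N))
         coset-injective coset-surjective (bound n n<N) (bound′ n n<N) ⟩
  sumL (λ y → twoThetas (coset y) n) (triples N)
    ≡⟨ sumL-cong (λ y → cong (λ f → f n) (twoThetas-coset y)) (triples N) ⟩
  sumL (λ y → splitThetas y n) (triples N)
    ≡⟨ ∑L-coeff splitThetas (triples N) n ⟨
  ∑L splitThetas (triples N) n ∎
  where
  open ≡-Reasoning
  -- The 1 lost in the bounds by `abs≤1+quad` is regained from the strict n < N, so boxes of radius
  -- N suffice.
  small : ∀ {m a n} → n < N → ∣ m ∣ ≤ suc a → a ≤ n → m ∈ ints N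
  small n<N m≤ a≤n = ∈-ints _ (ℕₚ.≤-trans m≤ (ℕₚ.≤-trans (s≤s a≤n) n<N))

  bound : ∀ n → n < N → ∀ x → twoThetas x n ≢ 0ℤ → x ∈ pairs N
  bound n n<N (k , l) ≢0 = ∈-cartesianProduct⁺
    (small n<N (abs≤1+quad 8 1 k) (subst (quad 9 1 k ≤_) degree (ℕₚ.m≤m+n _ _)))
    (small n<N (abs≤1+quad 7 12 l) (subst (quad 8 12 l ≤_) degree (ℕₚ.m≤n+m _ _)))
    where
    degree : quad 9 1 k ℕ.+ quad 8 12 l ≡ n
    degree = mono-degree _ _ ≢0

  bound′ : ∀ n → n < N → ∀ y → twoThetas (coset y) n ≢ 0ℤ → y ∈ triples N
  bound′ n n<N (i , u , v) ≢0 = ∈-cartesianProduct⁺ (∈-allFin i) (∈-cartesianProduct⁺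
    (small n<N (formᵤ-bound i u)
      (subst (formᵤ i u ≤_) degree (ℕₚ.≤-trans (ℕₚ.m≤m+n _ _) (ℕₚ.m≤n+m _ (shift i)))))
    (small n<N (formᵥ-bound i v)
      (subst (formᵥ i v ≤_) degree (ℕₚ.≤-trans (ℕₚ.m≤n+m _ (formᵤ i u)) (ℕₚ.m≤n+m _ (shift i))))))
    where
    degree : shift i ℕ.+ (formᵤ i u ℕ.+ formᵥ i v) ≡ n
    degree = trans (sym (coset-form i u v)) (mono-degree _ _ ≢0)

theta-product : ∀ {N} → theta 1ℤ 9 1 N ⊗ theta -1ℤ 8 12 N ≈[ N ]
  (theta -1ℤ 17 13 N ⊕ mono 1ℤ 1 ⊗ theta -1ℤ 23 7 N) ⊗ theta -1ℤ 40 20 N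
theta-product {N} = begin
  theta 1ℤ 9 1 N ⊗ theta -1ℤ 8 12 N
    ≈⟨ Ring.*-cong (theta-∑L 1ℤ 9 1 N) (theta-∑L -1ℤ 8 12 N) ⟩
  ∑L (thetaTerm 1ℤ 9 1) (ints N) ⊗ ∑L (thetaTerm -1ℤ 8 12) (ints N)
    ≈⟨ ∑L-product (thetaTerm 1ℤ 9 1) (thetaTerm -1ℤ 8 12) (ints N) (ints N) ⟨
  ∑L (λ (m , n) → thetaTerm 1ℤ 9 1 m ⊗ thetaTerm -1ℤ 8 12 n) (pairs N)
    ≈⟨ ∑L-cong (λ (m , n) → mono-* (1ℤ ℤ.^ ∣ m ∣) (quad 9 1 m) (parity n) (quad 8 12 n)) (pairs N) ⟩
  ∑L twoThetas (pairs N)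
    ≈⟨ twoThetas-reindex ⟩
  ∑L splitThetas (triples N)
    ≈⟨ Ring.trans (∑L-++ splitThetas (map (0F ,_) (pairs N)) _)
         (Ring.+-cong Ring.refl (Ring.trans (∑L-++ splitThetas (map (1F ,_) (pairs N)) _)
           (Ring.+-cong Ring.refl (∑L-++ splitThetas (map (2F ,_) (pairs N)) _)))) ⟩
  part 0F ⊕ (part 1F ⊕ (part 2F ⊕ zeroPS))
    ≈⟨ Ring.+-cong (factorise 0F 17 13 40 20 (λ _ → refl) λ _ → refl) (Ring.+-cong
         (factorise 1F 23 7 40 20 (λ _ → refl) λ _ → refl) (Ring.+-cong
         (factorise 2F 27 3 60 0 (λ _ → refl) λ _ → refl) Ring.refl)) ⟩
  mono 1ℤ 0 ⊗ (θ₁ ⊗ θ₃) ⊕ (mono 1ℤ 1 ⊗ (θ₂ ⊗ θ₃) ⊕ (mono 1ℤ 9 ⊗ (θ₄ ⊗ theta -1ℤ 60 0 N) ⊕ zeroPS))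
    ≈⟨ Ring.+-cong (Ring.*-cong (exact mono-1) Ring.refl) (Ring.+-cong Ring.refl (Ring.+-cong
         (Ring.*-cong Ring.refl (Ring.*-cong Ring.refl theta-vanishes)) Ring.refl)) ⟩
  onePS ⊗ (θ₁ ⊗ θ₃) ⊕ (mono 1ℤ 1 ⊗ (θ₂ ⊗ θ₃) ⊕ (mono 1ℤ 9 ⊗ (θ₄ ⊗ zeroPS) ⊕ zeroPS))
    ≈⟨ solve 6 (λ x y z w q s →
           con 1 :* (x :* z) :+ (q :* (y :* z) :+ (s :* (w :* con 0) :+ con 0)) :=
           (x :+ q :* y) :* z)
         Ring.refl θ₁ θ₂ θ₃ θ₄ (mono 1ℤ 1) (mono 1ℤ 9) ⟩
  (θ₁ ⊕ mono 1ℤ 1 ⊗ θ₂) ⊗ θ₃ ∎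
  where
  open ≈-Reasoning {N}
  open import Algebra.Solver.Ring.NaturalCoefficients.Default (truncated N)
  θ₁ θ₂ θ₃ θ₄ : PS
  θ₁ = theta -1ℤ 17 13 N
  θ₂ = theta -1ℤ 23 7 N
  θ₃ = theta -1ℤ 40 20 N
  θ₄ = theta -1ℤ 27 3 N

  part : Fin 3 → PS
  part i = ∑L splitThetas (map (i ,_) (pairs N))

  factorise : ∀ i p r p′ r′ → (∀ u → formᵤ i u ≡ quad p r u) → (∀ v → formᵥ i v ≡ quad p′ r′ v) →
    part i ≈[ N ] mono 1ℤ (shift i) ⊗ (theta -1ℤ p r N ⊗ theta -1ℤ p′ r′ N)
  factorise i p r p′ r′ formᵤ≡ formᵥ≡ = begin
    part i
      ≈⟨ ∑L-map splitThetas (i ,_) (pairs N) ⟩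
    ∑L (λ (u , v) → splitThetas (i , u , v)) (pairs N)
      ≈⟨ ∑L-cong (λ (u , v) → term u v) (pairs N) ⟩
    ∑L (λ (u , v) → mono 1ℤ (shift i) ⊗ (thetaTerm -1ℤ p r u ⊗ thetaTerm -1ℤ p′ r′ v)) (pairs N)
      ≈⟨ ∑L-⊗ˡ (mono 1ℤ (shift i)) _ (pairs N) ⟩
    mono 1ℤ (shift i) ⊗ ∑L (λ (u , v) → thetaTerm -1ℤ p r u ⊗ thetaTerm -1ℤ p′ r′ v) (pairs N)
      ≈⟨ Ring.*-cong Ring.refl (Ring.trans (∑L-product _ _ (ints N) (ints N))
           (Ring.sym (Ring.*-cong (theta-∑L -1ℤ p r N) (theta-∑L -1ℤ p′ r′ N)))) ⟩
    mono 1ℤ (shift i) ⊗ (theta -1ℤ p r N ⊗ theta -1ℤ p′ r′ N) ∎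
    where
    term : ∀ u v → splitThetas (i , u , v) ≈[ N ]
           mono 1ℤ (shift i) ⊗ (thetaTerm -1ℤ p r u ⊗ thetaTerm -1ℤ p′ r′ v)
    term u v rewrite formᵤ≡ u | formᵥ≡ v = Ring.sym (Ring.trans
      (Ring.*-cong Ring.refl (mono-* (parity u) (quad p r u) (parity v) (quad p′ r′ v)))
      (mono-* 1ℤ (shift i) (parity u ℤ.* parity v) (quad p r u ℕ.+ quad p′ r′ v)))

-- The enumeration of the m with 15m + 1 a square

-- inj₁ u stands for the root |15u + 1| and inj₂ u for the root |15u + 4|.
value : ℤ ⊎ ℤ → ℕ
value (inj₁ u) = quad 17 13 u
value (inj₂ u) = suc (quad 23 7 u)

-- The order of the roots: 15t + 1 and 15t + 4 from u = t, then 15t + 11 = |15(-1-t) + 4| and 15t +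
-- 14 = |15(-1-t) + 1|, then 15(t+1) + 1.
next : ℤ ⊎ ℤ → ℤ ⊎ ℤ
next (inj₁ (+ t))    = inj₂ (+ t)
next (inj₂ (+ t))    = inj₂ -[1+ t ]
next (inj₂ -[1+ t ]) = inj₁ -[1+ t ]
next (inj₁ -[1+ t ]) = inj₁ (+ suc t)

index : ℕ → ℤ ⊎ ℤ
index zero    = inj₁ (+ 0)
index (suc n) = next (index n)

position : ℤ ⊎ ℤ → ℕ
position (inj₁ (+ t))    = t ℕ.* 4
position (inj₂ (+ t))    = 1 ℕ.+ t ℕ.* 4
position (inj₂ -[1+ t ]) = 2 ℕ.+ t ℕ.* 4
position (inj₁ -[1+ t ]) = 3 ℕ.+ t ℕ.* 4

position-next : ∀ x → position (next x) ≡ suc (position x)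
position-next (inj₁ (+ t))    = refl
position-next (inj₂ (+ t))    = refl
position-next (inj₂ -[1+ t ]) = refl
position-next (inj₁ -[1+ t ]) = refl

position-index : ∀ n → position (index n) ≡ n
position-index zero    = refl
position-index (suc n) = trans (position-next (index n)) (cong suc (position-index n))

index-position : ∀ x → index (position x) ≡ x
index-position (inj₁ (+ t)) = multiples t
  where
  multiples : ∀ t → index (t ℕ.* 4) ≡ inj₁ (+ t)
  multiples zero    = refl
  multiples (suc t) = cong (next ∘ next ∘ next ∘ next) (multiples t)
index-position (inj₂ (+ t))    = cong next (index-position (inj₁ (+ t)))
index-position (inj₂ -[1+ t ]) = cong (next ∘ next) (index-position (inj₁ (+ t)))
index-position (inj₁ -[1+ t ]) = cong (next ∘ next ∘ next) (index-position (inj₁ (+ t)))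

private
  exceeds : ∀ {m n} k → 0 < k → n ≡ m ℕ.+ k → m < n
  exceeds {m} (suc k) _ refl = subst (suc m ≤_) (sym (ℕₚ.+-suc m k)) (ℕₚ.m≤m+n (suc m) k)

-- The four gaps are 6t + 1, 14t + 7, 6t + 5 and 4t + 4. Nonnegative indices are split again at t =
-- 0 because `quad` involves `tri (pred n)` there.
value-next : ∀ x → value x < value (next x)
value-next (inj₁ (+ zero))  = s≤s z≤n
value-next (inj₁ (+ suc t)) = s≤s (subst (quad 17 13 (+ suc t) ≤_) (sym (step 17 7 6 t (tri t))) (ℕₚ.m≤m+n _ _))
  where
  step : ∀ p r k t T → (p ℕ.+ k) ℕ.* (suc t ℕ.+ T) ℕ.+ r ℕ.* T ≡
    p ℕ.* (suc t ℕ.+ T) ℕ.+ (r ℕ.+ k) ℕ.* T ℕ.+ k ℕ.* suc t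
  step = ℕ-Solver.solve-∀
value-next (inj₂ (+ zero))  = s≤s (s≤s z≤n)
value-next (inj₂ (+ suc t)) = s≤s (exceeds (7 ℕ.* (suc (suc t) ℕ.+ suc t)) (s≤s z≤n) (step 23 7 t (tri t)))
  where
  step : ∀ p r t T → p ℕ.* (suc t ℕ.+ T) ℕ.+ r ℕ.* (suc (suc t) ℕ.+ (suc t ℕ.+ T)) ≡
    p ℕ.* (suc t ℕ.+ T) ℕ.+ r ℕ.* T ℕ.+ r ℕ.* (suc (suc t) ℕ.+ suc t)
  step = ℕ-Solver.solve-∀
value-next (inj₂ -[1+ t ]) = exceeds (t ℕ.+ 5 ℕ.* suc t) (ℕₚ.≤-trans (s≤s z≤n) (ℕₚ.m≤n+m (5 ℕ.* suc t) t))
  (trans (step 17 7 6 t (tri t)) (ℕₚ.+-suc (23 ℕ.* tri t ℕ.+ 7 ℕ.* tri (suc t)) (t ℕ.+ 5 ℕ.* suc t)))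
  where
  step : ∀ p r k t T → p ℕ.* T ℕ.+ (r ℕ.+ k) ℕ.* (suc t ℕ.+ T) ≡
    (p ℕ.+ k) ℕ.* T ℕ.+ r ℕ.* (suc t ℕ.+ T) ℕ.+ k ℕ.* suc t
  step = ℕ-Solver.solve-∀
value-next (inj₁ -[1+ t ]) = exceeds (4 ℕ.* suc t) (s≤s z≤n) (step 13 4 t (tri t))
  where
  step : ∀ p k t T → (p ℕ.+ k) ℕ.* (suc t ℕ.+ T) ℕ.+ p ℕ.* T ≡
    (p ℕ.+ k) ℕ.* T ℕ.+ p ℕ.* (suc t ℕ.+ T) ℕ.+ k ℕ.* suc t
  step = ℕ-Solver.solve-∀

-- Square roots of 15m + 1

root : ℤ ⊎ ℤ → ℤ
root (inj₁ u) = u ℤ.* + 15 ℤ.+ + 1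
root (inj₂ u) = u ℤ.* + 15 ℤ.+ + 4

value-root : ∀ x → 15 ℕ.* value x ℕ.+ 1 ≡ ∣ root x ∣ ℕ.* ∣ root x ∣
value-root x = trans (cong ∣_∣ (ℤₚ.*-cancelʳ-≡ (+ (15 ℕ.* value x ℕ.+ 1)) (root x ℤ.* root x) (+ 2) (doubled x)))
                     (ℤₚ.abs-* (root x) (root x))
  where
  open ≡-Reasoning
  doubled : ∀ x → + (15 ℕ.* value x ℕ.+ 1) ℤ.* + 2 ≡ root x ℤ.* root x ℤ.* + 2
  doubled (inj₁ u) = begin
    (+ (15 ℕ.* quad 17 13 u) ℤ.+ + 1) ℤ.* + 2
      ≡⟨ cong (λ z → (z ℤ.+ + 1) ℤ.* + 2) (ℤₚ.pos-* 15 (quad 17 13 u)) ⟩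
    (+ 15 ℤ.* + quad 17 13 u ℤ.+ + 1) ℤ.* + 2
      ≡⟨ expand (+ quad 17 13 u) (+ 2) ⟩
    + 15 ℤ.* (+ quad 17 13 u ℤ.* + 2) ℤ.+ + 2
      ≡⟨ cong (λ z → + 15 ℤ.* z ℤ.+ + 2) (quad-double 17 13 u) ⟩
    + 15 ℤ.* quadℤ 17 13 u ℤ.+ + 2
      ≡⟨ square u ⟩
    root (inj₁ u) ℤ.* root (inj₁ u) ℤ.* + 2 ∎
    where
    expand : ∀ z c → (+ 15 ℤ.* z ℤ.+ + 1) ℤ.* c ≡ + 15 ℤ.* (z ℤ.* c) ℤ.+ c
    expand = solve-∀
    square : ∀ u → + 15 ℤ.* (+ 30 ℤ.* (u ℤ.* u) ℤ.+ + 4 ℤ.* u) ℤ.+ + 2 ≡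
             (u ℤ.* + 15 ℤ.+ + 1) ℤ.* (u ℤ.* + 15 ℤ.+ + 1) ℤ.* + 2
    square = solve-∀
  doubled (inj₂ u) = begin
    (+ (15 ℕ.* suc (quad 23 7 u)) ℤ.+ + 1) ℤ.* + 2
      ≡⟨ cong (λ z → (z ℤ.+ + 1) ℤ.* + 2) (ℤₚ.pos-* 15 (suc (quad 23 7 u))) ⟩
    (+ 15 ℤ.* (+ 1 ℤ.+ + quad 23 7 u) ℤ.+ + 1) ℤ.* + 2
      ≡⟨ expand (+ quad 23 7 u) (+ 2) ⟩
    + 15 ℤ.* (+ quad 23 7 u ℤ.* + 2) ℤ.+ + 16 ℤ.* + 2
      ≡⟨ cong (λ z → + 15 ℤ.* z ℤ.+ + 16 ℤ.* + 2) (quad-double 23 7 u) ⟩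
    + 15 ℤ.* quadℤ 23 7 u ℤ.+ + 16 ℤ.* + 2
      ≡⟨ square u ⟩
    root (inj₂ u) ℤ.* root (inj₂ u) ℤ.* + 2 ∎
    where
    expand : ∀ z c → (+ 15 ℤ.* (+ 1 ℤ.+ z) ℤ.+ + 1) ℤ.* c ≡ + 15 ℤ.* (z ℤ.* c) ℤ.+ + 16 ℤ.* c
    expand = solve-∀
    square : ∀ u → + 15 ℤ.* (+ 30 ℤ.* (u ℤ.* u) ℤ.+ + 16 ℤ.* u) ℤ.+ + 32 ≡
             (u ℤ.* + 15 ℤ.+ + 4) ℤ.* (u ℤ.* + 15 ℤ.+ + 4) ℤ.* + 2
    square = solve-∀

-- The square roots of 1 modulo 15 are 1, 4, 11 and 14. The last two arise from negative u, with the
-- representative -1-q.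
root-surjective : ∀ ρ q → ρ < 15 → (ρ ℕ.* ρ) % 15 ≡ 1 → ∃ λ x → ∣ root x ∣ ≡ ρ ℕ.+ q ℕ.* 15
root-surjective ρ q = go ρ
  where
  nonneg : ∀ c → ∣ + q ℤ.* + 15 ℤ.+ + c ∣ ≡ c ℕ.+ q ℕ.* 15
  nonneg c = trans (cong (λ z → ∣ z ℤ.+ + c ∣) (sym (ℤₚ.pos-* q 15))) (ℕₚ.+-comm (q ℕ.* 15) c)

  neg : ∀ c d → + c ℤ.+ + d ≡ + 15 → ∣ -[1+ q ] ℤ.* + 15 ℤ.+ + c ∣ ≡ d ℕ.+ q ℕ.* 15
  neg c d c+d≡15 = begin
    ∣ -[1+ q ] ℤ.* + 15 ℤ.+ + c ∣
      ≡⟨ cong (λ z → ∣ -[1+ q ] ℤ.* z ℤ.+ + c ∣) (sym c+d≡15) ⟩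
    ∣ - (1ℤ ℤ.+ + q) ℤ.* (+ c ℤ.+ + d) ℤ.+ + c ∣
      ≡⟨ cong ∣_∣ (rearrange (+ q) (+ c) (+ d)) ⟩
    ∣ - (+ d ℤ.+ + q ℤ.* (+ c ℤ.+ + d)) ∣
      ≡⟨ ℤₚ.∣-i∣≡∣i∣ (+ d ℤ.+ + q ℤ.* (+ c ℤ.+ + d)) ⟩
    ∣ + d ℤ.+ + q ℤ.* (+ c ℤ.+ + d) ∣
      ≡⟨ cong (λ z → ∣ + d ℤ.+ + q ℤ.* z ∣) c+d≡15 ⟩
    ∣ + d ℤ.+ + q ℤ.* + 15 ∣
      ≡⟨ cong (λ z → ∣ + d ℤ.+ z ∣) (sym (ℤₚ.pos-* q 15)) ⟩
    d ℕ.+ q ℕ.* 15 ∎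
    where
    open ≡-Reasoning
    rearrange : ∀ q c d → - (1ℤ ℤ.+ q) ℤ.* (c ℤ.+ d) ℤ.+ c ≡ - (d ℤ.+ q ℤ.* (c ℤ.+ d))
    rearrange = solve-∀

  go : ∀ ρ → ρ < 15 → (ρ ℕ.* ρ) % 15 ≡ 1 → ∃ λ x → ∣ root x ∣ ≡ ρ ℕ.+ q ℕ.* 15
  go 1  _ _ = inj₁ (+ q) , nonneg 1
  go 4  _ _ = inj₂ (+ q) , nonneg 4
  go 11 _ _ = inj₂ -[1+ q ] , neg 4 11 refl
  go 14 _ _ = inj₁ -[1+ q ] , neg 1 14 refl
  go 0 _ ()
  go 2 _ ()
  go 3 _ ()
  go 5 _ ()
  go 6 _ ()
  go 7 _ ()
  go 8 _ ()
  go 9 _ ()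
  go 10 _ ()
  go 12 _ ()
  go 13 _ ()
  go (suc (suc (suc (suc (suc (suc (suc (suc (suc (suc (suc (suc (suc (suc (suc ρ)))))))))))))))
     (s≤s (s≤s (s≤s (s≤s (s≤s (s≤s (s≤s (s≤s (s≤s (s≤s (s≤s (s≤s (s≤s (s≤s (s≤s ()))))))))))))))) _

square-residue : ∀ m k → 15 ℕ.* m ℕ.+ 1 ≡ k ℕ.* k → (k % 15 ℕ.* (k % 15)) % 15 ≡ 1
square-residue m k 15m+1≡k² = begin
  (k % 15 ℕ.* (k % 15)) % 15   ≡⟨ %-distribˡ-* k k 15 ⟨
  (k ℕ.* k) % 15               ≡⟨ cong (_% 15) 15m+1≡k² ⟨
  (15 ℕ.* m ℕ.+ 1) % 15        ≡⟨ cong (_% 15) (trans (ℕₚ.+-comm (15 ℕ.* m) 1) (cong suc (ℕₚ.*-comm 15 m))) ⟩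
  (1 ℕ.+ m ℕ.* 15) % 15        ≡⟨ [m+kn]%n≡m%n 1 m 15 ⟩
  1                            ∎
  where open ≡-Reasoning

value-determined : ∀ x m → 15 ℕ.* m ℕ.+ 1 ≡ ∣ root x ∣ ℕ.* ∣ root x ∣ → value x ≡ m
value-determined x m eq = ℕₚ.*-cancelˡ-≡ (value x) m 15
  (ℕₚ.+-cancelʳ-≡ 1 (15 ℕ.* value x) (15 ℕ.* m) (trans (value-root x) (sym eq)))

value-surjective : ∀ m → Sq15 m → ∃ λ x → value x ≡ m
value-surjective m (k , 15m+1≡k²) = x , value-determined x m
  (trans 15m+1≡k² (sym (cong₂ ℕ._*_ root≡k root≡k)))
  where
  preimage : ∃ λ x → ∣ root x ∣ ≡ k % 15 ℕ.+ k / 15 ℕ.* 15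
  preimage = root-surjective (k % 15) (k / 15) (m%n<n k 15) (square-residue m k 15m+1≡k²)
  x : ℤ ⊎ ℤ
  x = proj₁ preimage
  root≡k : ∣ root x ∣ ≡ k
  root≡k = trans (proj₂ preimage) (sym (m≡m%n+[m/n]*n k 15))

-- Uniqueness of the increasing enumeration

Increasing : (ℕ → ℕ) → Set
Increasing f = ∀ n → f n < f (suc n)

increasing⇒monotone : ∀ {f} → Increasing f → ∀ {i j} → i ≤ j → f i ≤ f j
increasing⇒monotone {f} f↑ {i} i≤j with ℕₚ.m≤n⇒∃[o]m+o≡n i≤j
... | k , refl = go k
  where
  go : ∀ k → f i ≤ f (i ℕ.+ k)
  go zero    rewrite ℕₚ.+-identityʳ i = ℕₚ.≤-refl
  go (suc k) rewrite ℕₚ.+-suc i k = ℕₚ.≤-trans (go k) (ℕₚ.<⇒≤ (f↑ (i ℕ.+ k)))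

increasing⇒expanding : ∀ {f} → Increasing f → ∀ n → n ≤ f n
increasing⇒expanding f↑ zero    = z≤n
increasing⇒expanding f↑ (suc n) = ℕₚ.≤-<-trans (increasing⇒expanding f↑ n) (f↑ n)

-- The index h n with f (h n) = g n is strictly increasing in n, so n ≤ h n and f n ≤ f (h n) = g n.
enumeration-≤ : ∀ {f g} → Increasing f → Increasing g → (∀ n → ∃ λ k → f k ≡ g n) → ∀ n → f n ≤ g n
enumeration-≤ {f} {g} f↑ g↑ cover n = subst (f n ≤_) (proj₂ (cover n))
  (increasing⇒monotone f↑ (increasing⇒expanding h↑ n))
  where
  h↑ : Increasing (proj₁ ∘ cover)
  h↑ n = ℕₚ.≰⇒> λ h≤ → ℕₚ.<⇒≱ (g↑ n)
    (subst₂ _≤_ (proj₂ (cover (suc n))) (proj₂ (cover n)) (increasing⇒monotone f↑ h≤))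

value∘index-increasing : Increasing (value ∘ index)
value∘index-increasing n = value-next (index n)

value-square : ∀ x → Sq15 (value x)
value-square x = ∣ root x ∣ , value-root x

enumeration-unique : ∀ a → IsEnumeration a → ∀ n → a n ≡ value (index n)
enumeration-unique a (a↑ , a-sound , a-complete) n = ℕₚ.≤-antisym
  (enumeration-≤ {a} {value ∘ index} a↑ value∘index-increasing
    (λ n → a-complete (value (index n)) (value-square (index n))) n)
  (enumeration-≤ {value ∘ index} {a} value∘index-increasing a↑ covered n)
  where
  covered : ∀ n → ∃ λ k → value (index k) ≡ a n
  covered n = position x , trans (cong value (index-position x)) (proj₂ preimage)
    where
    preimage : ∃ λ x → value x ≡ a n
    preimage = value-surjective (a n) (a-sound n)
    x : ℤ ⊎ ℤ
    x = proj₁ preimage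

-- Signs along the enumeration

sign : ℤ ⊎ ℤ → ℤ
sign (inj₁ u) = parity u
sign (inj₂ u) = parity u

-- For n = 4t + r with r < 4, the quotient of n + 2 by 4 is t when r ≤ 1 and t + 1 otherwise; in all
-- four cases this is |u|.
sgn-position : ∀ x → sgn (position x) ≡ sign x
sgn-position x = trans (sgn-power (position x)) (exponent x)
  where
  -- The case split of `sgn` with the residue as an argument, so that it can be rewritten along the
  -- induction on the quotient.
  pick : ℕ → ℤ
  pick ρ with ρ ℕ.≟ 0
  ... | yes _ = 1ℤ
  ... | no  _ = -1ℤ

  pick-power : ∀ k → pick (k % 2) ≡ -1ℤ ℤ.^ k
  pick-power zero = refl
  pick-power (suc zero) = refl
  pick-power (suc (suc k)) = trans
    (cong pick (trans (cong (_% 2) (ℕₚ.+-comm 2 k)) ([m+n]%n≡m%n k 2)))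
    (trans (pick-power k) (square (-1ℤ ℤ.^ k)))
    where
    square : ∀ x → x ≡ -1ℤ ℤ.* (-1ℤ ℤ.* x)
    square = solve-∀

  sgn-power : ∀ n → sgn n ≡ -1ℤ ℤ.^ ((2 ℕ.+ n) / 4)
  sgn-power n = trans sgn-pick
    (trans (pick-power ((n ℕ.+ 2) / 4)) (cong (λ m → -1ℤ ℤ.^ (m / 4)) (ℕₚ.+-comm n 2)))
    where
    sgn-pick : sgn n ≡ pick (((n ℕ.+ 2) / 4) % 2)
    sgn-pick with ((n ℕ.+ 2) / 4) % 2 ℕ.≟ 0
    ... | yes _ = refl
    ... | no  _ = refl

  quotient : ∀ r t → (r ℕ.+ t ℕ.* 4) / 4 ≡ r / 4 ℕ.+ t
  quotient r t = trans (+-distrib-/-∣ʳ r (divides t refl)) (cong (r / 4 ℕ.+_) (m*n/n≡m t 4))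

  exponent : ∀ x → -1ℤ ℤ.^ ((2 ℕ.+ position x) / 4) ≡ sign x
  exponent (inj₁ (+ t))    = cong (-1ℤ ℤ.^_) (quotient 2 t)
  exponent (inj₂ (+ t))    = cong (-1ℤ ℤ.^_) (quotient 3 t)
  exponent (inj₂ -[1+ t ]) = cong (-1ℤ ℤ.^_) (quotient 4 t)
  exponent (inj₁ -[1+ t ]) = cong (-1ℤ ℤ.^_) (quotient 5 t)

-- The two sides of the identity

lhsTheta : ℕ → PS
lhsTheta K = theta -1ℤ 17 13 K ⊕ mono 1ℤ 1 ⊗ theta -1ℤ 23 7 K

signedTerm : ℤ ⊎ ℤ → PS
signedTerm x = mono (sign x) (value x)

bothInts : ℕ → List (ℤ ⊎ ℤ)
bothInts K = map inj₁ (ints K) ++ map inj₂ (ints K)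

bothInts-unique : ∀ K → Unique (bothInts K)
bothInts-unique K = Unique.++⁺ (Unique.map⁺ inj₁-injective (ints-unique K))
  (Unique.map⁺ inj₂-injective (ints-unique K)) disjoint
  where
  disjoint : ∀ {x} → ¬ (x ∈ map inj₁ (ints K) × x ∈ map inj₂ (ints K))
  disjoint (x∈₁ , x∈₂) with ∈-map⁻ inj₁ x∈₁ | ∈-map⁻ inj₂ x∈₂
  ... | _ , _ , refl | _ , _ , ()

lhsTheta-∑L : ∀ {N} K → lhsTheta K ≈[ N ] ∑L signedTerm (bothInts K)
lhsTheta-∑L {N} K = Ring.sym (begin
  ∑L signedTerm (bothInts K)
    ≈⟨ ∑L-++ signedTerm (map inj₁ (ints K)) (map inj₂ (ints K)) ⟩
  ∑L signedTerm (map inj₁ (ints K)) ⊕ ∑L signedTerm (map inj₂ (ints K))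
    ≈⟨ Ring.+-cong (∑L-map signedTerm inj₁ (ints K)) (∑L-map signedTerm inj₂ (ints K)) ⟩
  ∑L (signedTerm ∘ inj₁) (ints K) ⊕ ∑L (signedTerm ∘ inj₂) (ints K)
    ≈⟨ Ring.+-cong Ring.refl (∑L-cong shifted (ints K)) ⟩
  ∑L (thetaTerm -1ℤ 17 13) (ints K) ⊕ ∑L (λ u → mono 1ℤ 1 ⊗ thetaTerm -1ℤ 23 7 u) (ints K)
    ≈⟨ Ring.+-cong (Ring.sym (theta-∑L -1ℤ 17 13 K))
         (Ring.trans (∑L-⊗ˡ (mono 1ℤ 1) (thetaTerm -1ℤ 23 7) (ints K))
           (Ring.*-cong Ring.refl (Ring.sym (theta-∑L -1ℤ 23 7 K)))) ⟩
  lhsTheta K ∎)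
  where
  open ≈-Reasoning {N}
  shifted : ∀ u → signedTerm (inj₂ u) ≈[ N ] mono 1ℤ 1 ⊗ thetaTerm -1ℤ 23 7 u
  shifted u = Ring.sym (Ring.trans (mono-* 1ℤ 1 (parity u) (quad 23 7 u))
    (Ring.reflexive (cong (λ c → mono c (suc (quad 23 7 u))) (ℤₚ.*-identityˡ (parity u)))))

private
  summandOf : ∀ {f n} x → x ≡ sumTo f n → ℕ → ℤ
  summandOf {f} _ _ = f

  -- Recovers the local function of lhsSeries by unification.
  summand : (ℕ → ℕ) → ℕ → ℕ → ℤ
  summand a N = summandOf {n = suc N} (lhsSeries a N) refl

summand-mono : ∀ a N n → summand a N n ≡ mono (sgn n) (a n) N
summand-mono a N n with a n ℕ.≟ N
... | yes refl = sym (mono-on (sgn n) (a n))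
... | no  an≢N = sym (mono-off (sgn n) (a n) N an≢N)

-- The bijection `position` turns the sum over n into one over roots. Both lists cover the support,
-- since n ≤ `value (index n)` and |u| exceeds the value by at most 1; hence the radius `suc N`.
lhsSeries-theta : ∀ a → IsEnumeration a → ∀ N → lhsSeries a N ≡ lhsTheta (suc N) N
lhsSeries-theta a enum N = begin
  sumTo (summand a N) (suc N)
    ≡⟨ sumTo-cong (suc N) (λ n _ → trans (summand-mono a N n)
         (cong (λ e → mono (sgn n) e N) (enumeration-unique a enum n))) ⟩
  sumTo f (suc N)
    ≡⟨ sumTo-sumL f (suc N) ⟩
  sumL f (upTo (suc N))
    ≡⟨ sumL-reindex f position (Unique.upTo⁺ (suc N)) (bothInts-unique (suc N))
         (λ {x} {y} eq → trans (sym (index-position x)) (trans (cong index eq) (index-position y)))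
         (λ n → index n , position-index n) early bounded ⟩
  sumL (f ∘ position) (bothInts (suc N))
    ≡⟨ sumL-cong f∘position (bothInts (suc N)) ⟩
  sumL (λ x → signedTerm x N) (bothInts (suc N))
    ≡⟨ ∑L-coeff signedTerm (bothInts (suc N)) N ⟨
  ∑L signedTerm (bothInts (suc N)) N
    ≡⟨ coeff (lhsTheta-∑L {suc N} (suc N)) N ℕₚ.≤-refl ⟨
  lhsTheta (suc N) N ∎
  where
  open ≡-Reasoning
  f : ℕ → ℤ
  f n = mono (sgn n) (value (index n)) N

  f∘position : ∀ x → f (position x) ≡ signedTerm x N
  f∘position x = cong₂ (λ c y → mono c (value y) N) (sgn-position x) (index-position x)

  early : ∀ n → f n ≢ 0ℤ → n ∈ upTo (suc N)
  early n fn≢0 = ∈-upTo⁺ (s≤s (subst (n ≤_) (mono-degree (sgn n) (value (index n)) fn≢0)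
    (increasing⇒expanding value∘index-increasing n)))

  bounded : ∀ x → f (position x) ≢ 0ℤ → x ∈ bothInts (suc N)
  bounded x ≢0 = go x (mono-degree (sign x) (value x) (≢0 ∘ trans (f∘position x)))
    where
    go : ∀ x → value x ≡ N → x ∈ bothInts (suc N)
    go (inj₁ u) eq = ∈-++⁺ˡ (∈-map⁺ inj₁ (∈-ints u
      (ℕₚ.≤-trans (abs≤1+quad 16 13 u) (s≤s (ℕₚ.≤-reflexive eq)))))
    go (inj₂ u) eq = ∈-++⁺ʳ (map inj₁ (ints (suc N))) (∈-map⁺ inj₂ (∈-ints u
      (ℕₚ.≤-trans (abs≤1+quad 22 7 u) (ℕₚ.≤-trans (ℕₚ.≤-reflexive eq) (ℕₚ.n≤1+n N)))))

-- Product identities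

module Products (N : ℕ) where
  open ≈-Reasoning {N}
  open MonoidSolver (CommutativeSemiring.*-commutativeMonoid (truncated N))
    using (solve; _⊜_) renaming (_⊕_ to _∙_)

  infix 9 [_∶_] ⟨_∶_⟩
  [_∶_] ⟨_∶_⟩ : ℕ → ℕ → PS
  [ a ∶ b ] = pochTo -1ℤ a b N
  ⟨ a ∶ b ⟩ = pochTo 1ℤ a b N

  halves : ∀ a b → [ suc a ∶ suc b ] ≈[ N ]
    [ suc a ℕ.+ suc b ℕ.* 0 ∶ suc b ℕ.* 2 ] ⊗ [ suc a ℕ.+ suc b ℕ.* 1 ∶ suc b ℕ.* 2 ]
  halves a b = Ring.trans (dissection -1ℤ a b 1) (Ring.*-cong (Ring.*-identityˡ _) Ring.refl)

  -- Bisections read backwards: (q^4, q^12; q^16) is (q^4; q^8), and so on, so the whole numerator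
  -- is (q^2; q^2)_∞.
  even-part : [ 2 ∶ 8 ] ⊗ [ 6 ∶ 8 ] ⊗ [ 8 ∶ 8 ] ⊗ [ 4 ∶ 16 ] ⊗ [ 12 ∶ 16 ] ≈[ N ] [ 2 ∶ 2 ]
  even-part = begin
    [ 2 ∶ 8 ] ⊗ [ 6 ∶ 8 ] ⊗ [ 8 ∶ 8 ] ⊗ [ 4 ∶ 16 ] ⊗ [ 12 ∶ 16 ]
      ≈⟨ solve 5 (λ a b c d e → (((a ∙ b) ∙ c) ∙ d) ∙ e ⊜ (a ∙ b) ∙ ((d ∙ e) ∙ c)) Ring.refl
           [ 2 ∶ 8 ] [ 6 ∶ 8 ] [ 8 ∶ 8 ] [ 4 ∶ 16 ] [ 12 ∶ 16 ] ⟩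
    [ 2 ∶ 8 ] ⊗ [ 6 ∶ 8 ] ⊗ ([ 4 ∶ 16 ] ⊗ [ 12 ∶ 16 ] ⊗ [ 8 ∶ 8 ])
      ≈⟨ Ring.*-cong (halves 1 3) (Ring.*-cong (halves 3 7) Ring.refl) ⟨
    [ 2 ∶ 4 ] ⊗ ([ 4 ∶ 8 ] ⊗ [ 8 ∶ 8 ])
      ≈⟨ Ring.*-cong Ring.refl (halves 3 3) ⟨
    [ 2 ∶ 4 ] ⊗ [ 4 ∶ 4 ]
      ≈⟨ halves 1 1 ⟨
    [ 2 ∶ 2 ] ∎

  even-mod-10 : [ 2 ∶ 2 ] ≈[ N ] [ 2 ∶ 10 ] ⊗ [ 4 ∶ 10 ] ⊗ [ 6 ∶ 10 ] ⊗ [ 8 ∶ 10 ] ⊗ [ 10 ∶ 10 ]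
  even-mod-10 = Ring.trans (dissection -1ℤ 1 1 4)
    (Ring.*-cong (Ring.*-cong (Ring.*-cong (Ring.*-cong (Ring.*-identityˡ _) Ring.refl) Ring.refl) Ring.refl) Ring.refl)

  -- Euler's pentagonal number theorem in q^20: the three progressions 20, 40 and 60 modulo 60 make
  -- up all multiples of 20.
  theta-40-20 : theta -1ℤ 40 20 N ≈[ N ] [ 20 ∶ 20 ]
  theta-40-20 = Ring.trans (Ring.sym (TripleProduct.jacobi-triple-product -1ℤ refl 39 19))
    (Ring.sym (Ring.trans (dissection -1ℤ 19 19 2)
      (Ring.*-cong (Ring.*-cong (Ring.*-identityˡ _) Ring.refl) Ring.refl)))

  theta-9-1 : theta 1ℤ 9 1 N ≈[ N ] ⟨ 1 ∶ 10 ⟩ ⊗ ⟨ 9 ∶ 10 ⟩ ⊗ [ 10 ∶ 10 ]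
  theta-9-1 = Ring.sym (TripleProduct.jacobi-triple-product 1ℤ refl 8 0)

  theta-8-12 : theta -1ℤ 8 12 N ≈[ N ] [ 12 ∶ 20 ] ⊗ [ 8 ∶ 20 ] ⊗ [ 20 ∶ 20 ]
  theta-8-12 = Ring.sym (TripleProduct.jacobi-triple-product -1ℤ refl 7 11)

  -- The factor (q^20; q^20) brought in for `theta-product` reappears in the second triple product
  -- and cancels. By (1 + x)(1 - x) = 1 - x², the denominator factors at 1 and 9 modulo 10 merge
  -- with the first triple product into 2 and 18 modulo 20; joined with 12 and 8 these give 2 and 8
  -- modulo 10. The remaining 4, 6 and 10 complete (q^2; q^2).
  lhsTheta-product : lhsTheta N ⊗ ([ 1 ∶ 5 ] ⊗ [ 4 ∶ 5 ]) ≈[ N ] [ 2 ∶ 2 ]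
  lhsTheta-product = pochTo-cancel 19 19 N (begin
    lhsTheta N ⊗ ([ 1 ∶ 5 ] ⊗ [ 4 ∶ 5 ]) ⊗ [ 20 ∶ 20 ]
      ≈⟨ solve 3 (λ l p e → (l ∙ p) ∙ e ⊜ (l ∙ e) ∙ p) Ring.refl
           (lhsTheta N) ([ 1 ∶ 5 ] ⊗ [ 4 ∶ 5 ]) [ 20 ∶ 20 ] ⟩
    lhsTheta N ⊗ [ 20 ∶ 20 ] ⊗ ([ 1 ∶ 5 ] ⊗ [ 4 ∶ 5 ])
      ≈⟨ Ring.*-cong (Ring.trans (Ring.*-cong Ring.refl (Ring.sym theta-40-20)) (Ring.sym theta-product)) Ring.refl ⟩
    theta 1ℤ 9 1 N ⊗ theta -1ℤ 8 12 N ⊗ ([ 1 ∶ 5 ] ⊗ [ 4 ∶ 5 ])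
      ≈⟨ Ring.*-cong (Ring.*-cong theta-9-1 theta-8-12) (Ring.*-cong (halves 0 4) (halves 3 4)) ⟩
    ⟨ 1 ∶ 10 ⟩ ⊗ ⟨ 9 ∶ 10 ⟩ ⊗ [ 10 ∶ 10 ] ⊗ ([ 12 ∶ 20 ] ⊗ [ 8 ∶ 20 ] ⊗ [ 20 ∶ 20 ])
      ⊗ ([ 1 ∶ 10 ] ⊗ [ 6 ∶ 10 ] ⊗ ([ 4 ∶ 10 ] ⊗ [ 9 ∶ 10 ]))
      ≈⟨ solve 10 (λ p₁ p₉ t e₁₂ e₈ e₂₀ m₁ m₆ m₄ m₉ →
           (((p₁ ∙ p₉) ∙ t) ∙ ((e₁₂ ∙ e₈) ∙ e₂₀)) ∙ ((m₁ ∙ m₆) ∙ (m₄ ∙ m₉)) ⊜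
           (((((((p₁ ∙ m₁) ∙ e₁₂) ∙ m₄) ∙ m₆) ∙ (e₈ ∙ (p₉ ∙ m₉))) ∙ t) ∙ e₂₀)) Ring.refl
           ⟨ 1 ∶ 10 ⟩ ⟨ 9 ∶ 10 ⟩ [ 10 ∶ 10 ] [ 12 ∶ 20 ] [ 8 ∶ 20 ] [ 20 ∶ 20 ]
           [ 1 ∶ 10 ] [ 6 ∶ 10 ] [ 4 ∶ 10 ] [ 9 ∶ 10 ] ⟩
    ⟨ 1 ∶ 10 ⟩ ⊗ [ 1 ∶ 10 ] ⊗ [ 12 ∶ 20 ] ⊗ [ 4 ∶ 10 ] ⊗ [ 6 ∶ 10 ]
      ⊗ ([ 8 ∶ 20 ] ⊗ (⟨ 9 ∶ 10 ⟩ ⊗ [ 9 ∶ 10 ])) ⊗ [ 10 ∶ 10 ] ⊗ [ 20 ∶ 20 ]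
      ≈⟨ Ring.*-cong (Ring.*-cong (Ring.*-cong (Ring.*-cong (Ring.*-cong
           (Ring.trans (Ring.*-cong (pochTo-conjugate 1 10 N) Ring.refl) (Ring.sym (halves 1 9)))
           Ring.refl) Ring.refl)
           (Ring.trans (Ring.*-cong Ring.refl (pochTo-conjugate 9 10 N)) (Ring.sym (halves 7 9))))
           Ring.refl) Ring.refl ⟩
    [ 2 ∶ 10 ] ⊗ [ 4 ∶ 10 ] ⊗ [ 6 ∶ 10 ] ⊗ [ 8 ∶ 10 ] ⊗ [ 10 ∶ 10 ] ⊗ [ 20 ∶ 20 ]
      ≈⟨ Ring.*-cong (Ring.sym even-mod-10) Ring.refl ⟩
    [ 2 ∶ 2 ] ⊗ [ 20 ∶ 20 ] ∎)

  ⋆≈⊗ : ∀ {f f′ g} → f ≈[ N ] f′ → f ⋆ g ≈[ N ] f′ ⊗ g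
  ⋆≈⊗ {f} {f′} {g} eq = Ring.trans (exact λ n → sym (⊗-coeff f g n)) (Ring.*-cong eq Ring.refl)

  rhsSeries-theta : rhsSeries ≈[ N ] lhsTheta N
  rhsSeries-theta = begin
    rhsSeries
      ≈⟨ ⋆≈⊗ (⋆≈⊗ (⋆≈⊗ (⋆≈⊗ (⋆≈⊗ (⋆≈⊗ Ring.refl))))) ⟩
    poch 2 8 ⊗ poch 6 8 ⊗ poch 8 8 ⊗ poch 4 16 ⊗ poch 12 16 ⊗ invPoch 1 5 ⊗ invPoch 4 5
      ≈⟨ Ring.*-cong (Ring.*-cong (Ring.trans (Ring.*-cong (Ring.*-cong (Ring.*-cong (Ring.*-cong
           (poch-pochTo 1 7) (poch-pochTo 5 7)) (poch-pochTo 7 7)) (poch-pochTo 3 15)) (poch-pochTo 11 15))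
           even-part) Ring.refl) Ring.refl ⟩
    [ 2 ∶ 2 ] ⊗ invPoch 1 5 ⊗ invPoch 4 5
      ≈⟨ Ring.*-cong (Ring.*-cong (Ring.sym lhsTheta-product) Ring.refl) Ring.refl ⟩
    lhsTheta N ⊗ ([ 1 ∶ 5 ] ⊗ [ 4 ∶ 5 ]) ⊗ invPoch 1 5 ⊗ invPoch 4 5
      ≈⟨ solve 5 (λ l a b c d → ((l ∙ (a ∙ b)) ∙ c) ∙ d ⊜ (l ∙ (a ∙ c)) ∙ (b ∙ d)) Ring.refl
           (lhsTheta N) [ 1 ∶ 5 ] [ 4 ∶ 5 ] (invPoch 1 5) (invPoch 4 5) ⟩
    lhsTheta N ⊗ ([ 1 ∶ 5 ] ⊗ invPoch 1 5) ⊗ ([ 4 ∶ 5 ] ⊗ invPoch 4 5)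
      ≈⟨ Ring.*-cong (Ring.*-cong Ring.refl (invPoch-inverse 0 4)) (invPoch-inverse 3 4) ⟩
    lhsTheta N ⊗ onePS ⊗ onePS
      ≈⟨ Ring.trans (Ring.*-identityʳ _) (Ring.*-identityʳ _) ⟩
    lhsTheta N ∎

theorem11 : (a : ℕ → ℕ) → IsEnumeration a →
    ∀ N → lhsSeries a N ≡ rhsSeries N
theorem11 a enum N = trans (lhsSeries-theta a enum N)
  (sym (coeff (Products.rhsSeries-theta (suc N)) N ℕₚ.≤-refl))
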